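{- Suppose that $G$ is a connected ribbon graph and that $A,B\subseteq E(G)$ either both define plane-biseparations of $G$, or both define $\mathbb{R}\mathrm{P}^2$-biseparations of $G$. Then $A$ and $B$ are related by toggling join-summands.
   Context: A ribbon graph is a surface with boundary made of vertex discs and edge discs meeting in disjoint segments, each segment on the boundary of exactly one vertex and one edge, each edge containing exactly two segments; considered up to homeomorphism. For $A\subseteq E(G)$, $A^c=E(G)\setminus A$; $G|_A$ consists of edges of $A$ and incident vertices; $G-A$ deletes the edges of $A$ keeping all vertices. Euler genus $\gamma$: twice the genus if orientable, non-orientable genus otherwise, summed over components. Plane (resp. $\mathbb{R}\mathrm{P}^2$) ribbon graph: connected with $\gamma=0$ (resp. $\gamma=1$). $1$-sum: $G=P\oplus Q$ if $P,Q$ are non-trivial connected ribbon subgraphs of connected $G$ with $G=P\cup Q$ and $P\cap Q$ a single vertex $v$. It is a join $G=P\vee Q$ if moreover there is an arc on the boundary of $v$ met by all edges of $P$ incident to $v$ and by no edges of $Q$. Sequences $H_1\oplus\cdots\oplus H_l$, $H_1\vee\cdots\vee H_l$ are read left-associatively: $(\cdots(H_1\oplus H_2)\oplus\cdots)\oplus H_l$. $A$ defines a biseparation of connected $G$ if $A\in\{\emptyset,E(G)\}$, or $G$ can be written as a sequence of $1$-sums whose summands are the components of $G|_A$ and $G|_{A^c}$, each $1$-sum involving a component of $G|_A$ and one of $G|_{A^c}$. Plane-biseparation: a biseparation with every component of $G|_A$ and $G-A$ plane. $\mathbb{R}\mathrm{P}^2$-biseparation: a biseparation with exactly one component of $G|_A$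 or $G-A$ being $\mathbb{R}\mathrm{P}^2$ and all others plane. Toggling: if $G=H_1\vee\cdots\vee H_r$ ($r\ge1$) and $A\subseteq E(G)$, then $A\,\Delta\,E(H_i)$ is obtained from $A$ by toggling a join-summand. Sets $A,B$ are related by toggling join-summands if there is a sequence $A=A_1,\dots,A_n=B$ with each $A_{i+1}$ obtained from $A_i$ by toggling a join-summand. -}

module Defs where

open import Data.Nat using (ℕ; _+_)
open import Data.Bool using (Bool; true; false; _xor_)
open import Data.Fin using (Fin)
open import Data.Fin.Subset using (Subset; _∈_; _∉_; _⊆_; _∪_; ∁; ∣_∣; Nonempty)
  renaming (⊥ to ∅ₛ; ⊤ to Eₛ)
open import Data.Fin.Subset.Properties using (_∈?_)
open import Data.Vec using (zipWith)
open import Data.List using (List; []; _∷_; _++_; [_]; filter; length; allFin; foldr)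
import Data.List.Membership.Propositional as LM
open import Data.List.Relation.Unary.Any using (Any; any?)
open import Data.List.Relation.Unary.All using (All)
open import Data.List.Relation.Unary.Unique.Propositional using (Unique)
open import Data.Product using (Σ; ∃; ∃-syntax; _×_; _,_; proj₁)
open import Data.Sum using (_⊎_)
open import Relation.Binary.PropositionalEquality using (_≡_; _≢_)
open import Relation.Binary.Construct.Closure.ReflexiveTransitive using (Star)
open import Relation.Binary.Construct.Closure.Equivalence using (EqClosure)
import Data.Unit
import Data.Empty

-- Ribbon graphs, encoded combinatorially as signed rotation systems.
-- Vertices: Fin nV.  Edges: Fin nE.  Each edge e has two ends
-- (darts) (e , false) and (e , true).  rot v lists the darts at the
-- vertex v in their cyclic order around the boundary of the vertex
-- disc (a list read up to cyclic rotation).  twist e says whether the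
-- edge disc e is attached with a half-twist relative to the chosen
-- local orientations of the vertex discs.  Every ribbon graph is
-- represented (up to homeomorphism) by such data.

Dart : ℕ → Set
Dart nE = Fin nE × Bool

record RibbonGraph : Set where
  field
    nV nE      : ℕ
    rot        : Fin nV → List (Dart nE)
    twist      : Fin nE → Bool
    rot-unique : ∀ v → Unique (rot v)
    rot-cover  : ∀ (d : Dart nE) → ∃[ v ] (d LM.∈ rot v)
    rot-disj   : ∀ (d : Dart nE) u w → d LM.∈ rot u → d LM.∈ rot w → u ≡ w

_Δ_ : ∀ {n} → Subset n → Subset n → Subset n
A Δ B = zipWith _xor_ A B

CycSucc : ∀ {a} {X : Set a} → List X → X → X → Set a
CycSucc xs x y =
  (∃[ ys ] ∃[ zs ] (xs ≡ ys ++ x ∷ y ∷ zs))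
  ⊎ (∃[ ys ] (xs ≡ y ∷ ys ++ [ x ]))
  ⊎ (xs ≡ [ x ] × y ≡ x)

module RG (G : RibbonGraph) where
  open RibbonGraph G

  E : Set
  E = Subset nE

  rotIn : E → Fin nV → List (Dart nE)
  rotIn X v = filter (λ d → proj₁ d ∈? X) (rot v)

  -- v is a vertex of the ribbon subgraph G|_X
  Inc : E → Fin nV → Set
  Inc X v = Any (λ d → proj₁ d ∈ X) (rot v)

  nVerts : E → ℕ
  nVerts X = length (filter (λ v → any? (λ d → proj₁ d ∈? X) (rot v)) (allFin nV))

  Step : E → Fin nV → Fin nV → Set
  Step X u w = ∃[ e ] (e ∈ X × (((e , false) LM.∈ rot u × (e , true) LM.∈ rot w)
                                ⊎ ((e , true) LM.∈ rot u × (e , false) LM.∈ rot w)))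

  ConnectedG : Set
  ConnectedG = ∀ u w → Star (Step Eₛ) u w

  Connected : E → Set
  Connected X = ∀ u w → Inc X u → Inc X w → Star (Step X) u w

  Component : E → E → Set
  Component A X =
    X ⊆ A × Nonempty X × Connected X ×
    (∀ e e' v → e ∈ A → e' ∈ X → Any (λ d → proj₁ d ≡ e) (rot v)
       → Any (λ d → proj₁ d ≡ e') (rot v) → e ∈ X)

  -- Boundary components of G|_X.  A boundary point is a side
  -- (false = left, true = right, looking out of the vertex) of a dart.
  Pt : Set
  Pt = Dart nE × Bool

  data BdAdj (X : E) : Pt → Pt → Set where
    -- arc of the boundary of a vertex disc between consecutive darts
    vtx  : ∀ v d d' → CycSucc (rotIn X v) d d' → BdAdj X (d , false) (d' , true)
    untw : ∀ e s → e ∈ X → twist e ≡ false →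
           BdAdj X ((e , false) , s) ((e , true) , Data.Bool.not s)
    tw   : ∀ e s → e ∈ X → twist e ≡ true →
           BdAdj X ((e , false) , s) ((e , true) , s)

  PtIn : E → Pt → Set
  PtIn X ((e , _) , _) = e ∈ X

  Faces : E → ℕ → Set
  Faces X f = Σ (Pt → Fin f) λ c →
    (∀ p q → PtIn X p → PtIn X q → (c p ≡ c q → EqClosure (BdAdj X) p q)
                                 × (EqClosure (BdAdj X) p q → c p ≡ c q))
    × (∀ i → ∃[ p ] (PtIn X p × c p ≡ i))

  -- Euler genus g of a connected G|_X:  v - e + f = 2 - g
  EulerGenus : E → ℕ → Set
  EulerGenus X g = ∃[ f ] (Faces X f × nVerts X + f + g ≡ ∣ X ∣ + 2)

  Plane : E → Set
  Plane X = Connected X × EulerGenus X 0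

  RP2 : E → Set
  RP2 X = Connected X × EulerGenus X 1

  Disjoint : E → E → Set
  Disjoint P Q = ∀ e → e ∈ P → e ∉ Q

  OneSum : E → E → Fin nV → Set
  OneSum P Q v =
    Nonempty P × Nonempty Q × Disjoint P Q × Connected P × Connected Q ×
    Inc P v × Inc Q v × (∀ w → Inc P w → Inc Q w → w ≡ v)

  CyclicInterval : E → List (Dart nE) → Set
  CyclicInterval P xs = ∃[ ys ] ∃[ zs ] ∃[ ps ] ∃[ qs ]
    (xs ≡ ys ++ zs × zs ++ ys ≡ ps ++ qs ×
     All (λ d → proj₁ d ∈ P) ps × All (λ d → proj₁ d ∉ P) qs)

  Join : E → E → Fin nV → Set
  Join P Q v = OneSum P Q v × CyclicInterval P (rotIn (P ∪ Q) v)

  OneSumSeq : E → List E → Set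
  OneSumSeq acc []       = Data.Unit.⊤
  OneSumSeq acc (H ∷ Hs) = (∃[ v ] OneSum acc H v) × OneSumSeq (acc ∪ H) Hs

  JoinSeq : E → List E → Set
  JoinSeq acc []       = Data.Unit.⊤
  JoinSeq acc (H ∷ Hs) = (∃[ v ] Join acc H v) × JoinSeq (acc ∪ H) Hs

  union : List E → E
  union = foldr _∪_ ∅ₛ

  JoinDecomp : List E → Set
  JoinDecomp []       = Data.Empty.⊥
  JoinDecomp (H ∷ Hs) = JoinSeq H Hs × union (H ∷ Hs) ≡ Eₛ

  CompOf : E → E → Set
  CompOf A X = Component A X ⊎ Component (∁ A) X

  Biseparation : E → Set
  Biseparation A = A ≡ ∅ₛ ⊎ A ≡ Eₛ ⊎
    (∃[ H ] ∃[ Hs ] (OneSumSeq H Hs × union (H ∷ Hs) ≡ Eₛ ×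
       All (CompOf A) (H ∷ Hs) × Unique (H ∷ Hs) ×
       (∀ X → CompOf A X → X LM.∈ (H ∷ Hs))))

  -- components of G - A that carry edges are the components of G|_{A^c};
  -- the remaining ones are isolated vertices, which are plane.
  PlaneBiseparation : E → Set
  PlaneBiseparation A = Biseparation A × (∀ X → CompOf A X → Plane X)

  RP2Biseparation : E → Set
  RP2Biseparation A = Biseparation A ×
    ∃[ X ] (CompOf A X × RP2 X × (∀ Y → CompOf A Y → Y ≢ X → Plane Y))

  Toggle : E → E → Set
  Toggle A B = ∃[ Hs ] (JoinDecomp Hs × ∃[ H ] (H LM.∈ Hs × B ≡ A Δ H))

  RelatedByToggling : E → E → Set
  RelatedByToggling = Star Toggle

{-# OPTIONS --safe #-}
module Submission where

-- Let D = A Δ B.  Cutting G at a vertex w breaks it into pieces.  A biseparation never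
-- divides the darts of a piece at w between its two sides, so neither do A, B and D.
--
-- A piece inside D and a piece outside D do not cross at w: either A or B has both of them
-- on the same side, hence in one component X.  Two closed curves crossing once at w have
-- intersection number 1 modulo 2.  In a plane X the intersection form vanishes, because by
-- Euler's formula every cycle is the coboundary of a colouring of the faces.  In a projective
-- X the form has rank 1, so both curves reverse orientation; the other biseparation puts
-- them in different components, of which only one can be non-plane.
--
-- Since pieces inside and outside D do not cross, some pieces at w fill an interval of the
-- cyclic order, and G can be peeled by joins until every summand is inside or outside D.
-- Toggling the summands inside D leads from A to B.

open import Defs
open import Algebra.Bundles using (CommutativeRing)
open import Data.Bool using (Bool; true; false; not; _∧_; _∨_; _xor_; if_then_else_)
open import Data.Bool.Properties using (xor-same; xor-comm; xor-assoc; xor-identityʳ; ∧-zeroʳ; ∧-identityʳ; ∨-identityʳ; ∧-distribʳ-xor; not-involutive; not-¬; xor-∧-commutativeRing) renaming (_≟_ to _≟ᵇ_)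
open import Data.Empty using (⊥; ⊥-elim)
open import Data.Fin using (Fin; zero; suc; _↑ˡ_; _↑ʳ_; _≟_; funToFin; finToFun; splitAt)
import Data.Fin.Properties as FP
open import Data.Fin.Subset using (Subset; _∈_; _∉_; _⊆_; _∪_; _∩_; ∁; ⁅_⁆; ∣_∣; Nonempty) renaming (⊥ to ∅ₛ; ⊤ to Eₛ)
open import Data.Fin.Subset.Properties using (_∈?_; ∈⊤; ∉⊥; x∈p∩q⁺; x∈p∩q⁻; x∈p∪q⁻; x∈p∪q⁺; x∈⁅x⁆; x∈⁅y⁆⇒x≡y; x∉p⇒x∈∁p; x∈∁p⇒x∉p; p⊆p∪q; p⊂q⇒∣p∣<∣q∣; ∣p∣≤n; ⊆-antisym; ∪-assoc; ∪-identityˡ; ∪-identityʳ; nonempty?)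
open import Data.List as L using (List; []; _∷_; _++_; [_]; length; map; filter; allFin; foldl; foldr)
open import Data.List.Properties using (++-assoc; ++-identityʳ; filter-++; filter-accept; ∷-injective; length-map; foldl-++)
open import Data.List.Membership.Propositional using (find) renaming (_∈_ to _∈ₗ_; _∉_ to _∉ₗ_; lose to lose∈)
open import Data.List.Membership.Propositional.Properties using (∈-++⁺ˡ; ∈-++⁺ʳ; ∈-++⁻; ∈-∃++; ∈-map⁺; ∈-allFin; ∈-filter⁺; ∈-filter⁻; ∈-lookup)
open import Data.List.Relation.Binary.Sublist.Propositional as Sub using ([]; _∷_; _∷ʳ_; from∈; minimum) renaming (_⊆_ to _⊑_)
open import Data.List.Relation.Binary.Sublist.Propositional.Properties using (++⁺; ++⁺ˡ; ++⁺ʳ; length-mono-≤; filter-⊆)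
open import Data.List.Relation.Unary.All as All using (All; []; _∷_)
import Data.List.Relation.Unary.All.Properties as AllP
open import Data.List.Relation.Unary.AllPairs using ([]; _∷_)
open import Data.List.Relation.Unary.Any as Any using (Any; here; there; any?)
open import Data.List.Relation.Unary.Any.Properties using (lookup-index) renaming (++⁺ʳ to ++⁺ᵃ)
open import Data.List.Relation.Unary.Unique.Propositional using (Unique)
import Data.List.Relation.Unary.Unique.Propositional.Properties as U
open import Data.Nat using (ℕ; zero; suc; _+_; _^_; _≤_; _<_; z≤n; s≤s)
import Data.Nat.Properties as ℕ
open import Data.Product using (∃-syntax; ∃₂; _×_; _,_; proj₁; proj₂)
open import Data.Product.Properties using (≡-dec)
open import Data.Sum using (_⊎_; inj₁; inj₂)
open import Data.Unit using (⊤; tt)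
open import Data.Vec as V using (Vec; []; _∷_; lookup)
open import Data.Vec.Properties using ([]=⇒lookup; lookup⇒[]=; lookup-zipWith) renaming (≡-dec to ≡-decᵛ)
open import Function using (_∘_)
open import Function.Bundles using (Inverse)
open import Level using (Level)
import Relation.Binary.Construct.Closure.Equivalence as EqC
open import Relation.Binary.Construct.Closure.ReflexiveTransitive as Star using (Star; ε; _◅_; _◅◅_)
open import Relation.Binary.Definitions using (DecidableEquality)
open import Relation.Binary.PropositionalEquality using (_≡_; _≢_; refl; sym; trans; cong; cong₂; subst; subst₂; module ≡-Reasoning)
open import Relation.Nullary using (¬_; Dec; yes; no; does)
open import Relation.Nullary.Decidable using (dec-true; dec-false; _×-dec_; ¬?)

-- The only topological input is Euler's formula, so intersection numbers are obtained by counting.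
-- A curve parallel to a closed curve is recorded as the list `M` of darts that it crosses, and
-- `⨁ M (α ∘ proj₁)` is its intersection number with a cycle `α`. Coboundaries of face colourings
-- pair to zero with `M`, because the colour is restored after one turn around the curve; a nonzero
-- value therefore shows that `α` is independent of them. Colourings modulo constants and paths from
-- a root already fill the chain space of a plane `X` and leave one dimension in a projective one.
-- There, two cycles that cross once and one of which has self-intersection 0 would need two
-- dimensions. The list `M` and the chain `α` refer to `G` alone, so the self-intersection needed in
-- a projective component of one biseparation can be computed in a plane component of the other. The
-- obstacle in the peeling is that an interval at `w` controls colours at `w` only: the part that it
-- splits off may be mixed elsewhere, and the splitting has to be moved until it is not.

private
  variable
    a : Level
    A B : Set a

-- Arithmetic modulo 2 and parity sums.

xor-interchange : ∀ a b c d → (a xor b) xor (c xor d) ≡ (a xor c) xor (b xor d)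
xor-interchange = interchange
  where open import Algebra.Properties.CommutativeSemigroup (CommutativeRing.+-commutativeSemigroup xor-∧-commutativeRing)

xor-false⇒≡ : ∀ a b → a xor b ≡ false → a ≡ b
xor-false⇒≡ false false _ = refl
xor-false⇒≡ true true _ = refl

≢⇒≡not : ∀ {a b} → a ≢ b → a ≡ not b
≢⇒≡not {false} {false} h = ⊥-elim (h refl)
≢⇒≡not {false} {true} h = refl
≢⇒≡not {true} {false} h = refl
≢⇒≡not {true} {true} h = ⊥-elim (h refl)

⨁ : List A → (A → Bool) → Bool
⨁ [] f = false
⨁ (x ∷ xs) f = f x xor ⨁ xs f

⨁-++ : ∀ (xs ys : List A) f → ⨁ (xs ++ ys) f ≡ ⨁ xs f xor ⨁ ys f
⨁-++ [] ys f = refl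
⨁-++ (x ∷ xs) ys f = trans (cong (f x xor_) (⨁-++ xs ys f)) (sym (xor-assoc (f x) _ _))

⨁-cong : ∀ (xs : List A) {f g} → (∀ x → x ∈ₗ xs → f x ≡ g x) → ⨁ xs f ≡ ⨁ xs g
⨁-cong [] h = refl
⨁-cong (x ∷ xs) h = cong₂ _xor_ (h x (here refl)) (⨁-cong xs (λ y y∈ → h y (there y∈)))

⨁-zero : ∀ (xs : List A) {f} → (∀ x → x ∈ₗ xs → f x ≡ false) → ⨁ xs f ≡ false
⨁-zero [] h = refl
⨁-zero (x ∷ xs) h = cong₂ _xor_ (h x (here refl)) (⨁-zero xs (λ y y∈ → h y (there y∈)))

⨁-xor : ∀ (xs : List A) f g → ⨁ xs (λ x → f x xor g x) ≡ ⨁ xs f xor ⨁ xs g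
⨁-xor [] f g = refl
⨁-xor (x ∷ xs) f g = trans (cong ((f x xor g x) xor_) (⨁-xor xs f g)) (xor-interchange (f x) (g x) _ _)

⨁-∧ : ∀ (xs : List A) b f → ⨁ xs (λ x → b ∧ f x) ≡ b ∧ ⨁ xs f
⨁-∧ xs true f = refl
⨁-∧ xs false f = ⨁-zero xs (λ _ _ → refl)

⨁-swap : ∀ (xs : List A) (ys : List B) (f : A → B → Bool) →
  ⨁ xs (λ x → ⨁ ys (f x)) ≡ ⨁ ys (λ y → ⨁ xs (λ x → f x y))
⨁-swap [] ys f = sym (⨁-zero ys (λ _ _ → refl))
⨁-swap (x ∷ xs) ys f = trans (cong (⨁ ys (f x) xor_) (⨁-swap xs ys f)) (sym (⨁-xor ys (f x) _))

⨁-filter : ∀ {p} {P : A → Set p} (P? : ∀ x → Dec (P x)) (xs : List A) f →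
  (∀ x → ¬ P x → f x ≡ false) → ⨁ (filter P? xs) f ≡ ⨁ xs f
⨁-filter P? [] f h = refl
⨁-filter P? (x ∷ xs) f h with P? x
... | yes _ = cong (f x xor_) (⨁-filter P? xs f h)
... | no ¬p = trans (⨁-filter P? xs f h) (sym (cong (_xor ⨁ xs f) (h x ¬p)))

module _ {A : Set} (_≟_ : DecidableEquality A) where
  ⨁-∉ : ∀ xs y → y ∉ₗ xs → ⨁ xs (λ x → does (x ≟ y)) ≡ false
  ⨁-∉ xs y y∉ = ⨁-zero xs (λ x x∈ → dec-false (x ≟ y) (λ { refl → y∉ x∈ }))

  ⨁-∈ : ∀ {xs} → Unique xs → ∀ {y} → y ∈ₗ xs → ⨁ xs (λ x → does (x ≟ y)) ≡ true
  ⨁-∈ {x ∷ xs} (u ∷ us) (here refl) =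
    cong₂ _xor_ (dec-true (x ≟ x) refl) (⨁-∉ xs x (λ x∈ → All.lookup u x∈ refl))
  ⨁-∈ {x ∷ xs} (u ∷ us) {y} (there y∈) =
    trans (cong (_xor ⨁ xs (λ x → does (x ≟ y))) (dec-false (x ≟ y) (λ { refl → All.lookup u y∈ refl }))) (⨁-∈ us y∈)

-- Linear functionals over the field with two elements.

Linear : ∀ {m} → ((Fin m → Bool) → Bool) → Set
Linear F = ∀ x y → F (λ j → x j xor y j) ≡ F x xor F y

funToFin-cong : ∀ {m n} {f g : Fin m → Fin n} → (∀ i → f i ≡ g i) → funToFin f ≡ funToFin g
funToFin-cong {zero} h = refl
funToFin-cong {suc m} h = cong₂ Data.Fin.combine (h zero) (funToFin-cong (h ∘ suc))

-- With fewer than m functionals, two of the 2 ^ m points agree on all of them.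
trivial-kernel⇒≤ : ∀ {m} (Fs : List ((Fin m → Bool) → Bool)) → All Linear Fs →
  (∀ x → All (λ F → F x ≡ false) Fs → ∀ j → x j ≡ false) → m ≤ length Fs
trivial-kernel⇒≤ {m} Fs lin ker with m ℕ.≤? length Fs
... | yes m≤n = m≤n
... | no m≰n = ⊥-elim (collision (FP.pigeonhole (ℕ.^-monoʳ-< 2 (s≤s (s≤s z≤n)) (ℕ.≰⇒> m≰n)) code))
  where
    bool : Fin 2 → Bool
    bool = Inverse.to FP.2↔Bool
    bit : Bool → Fin 2
    bit = Inverse.from FP.2↔Bool
    bool-bit : ∀ b → bool (bit b) ≡ b
    bool-bit false = refl
    bool-bit true = refl
    bit-bool : ∀ i → bit (bool i) ≡ i
    bit-bool zero = refl
    bit-bool (suc zero) = refl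
    point : Fin (2 ^ m) → Fin m → Bool
    point i j = bool (finToFun i j)
    values : Fin (2 ^ m) → Fin (length Fs) → Fin 2
    values i k = bit (L.lookup Fs k (point i))
    code : Fin (2 ^ m) → Fin (2 ^ length Fs)
    code i = funToFin (values i)
    collision : (∃₂ λ i j → i Data.Fin.< j × code i ≡ code j) → ⊥
    collision (i , j , i<j , eq) = FP.<⇒≢ i<j
      (trans (sym (FP.funToFin-finToFin {m} i)) (trans (funToFin-cong same-digit) (FP.funToFin-finToFin {m} j)))
      where
        same-value : ∀ k → L.lookup Fs k (point i) ≡ L.lookup Fs k (point j)
        same-value k = trans (sym (bool-bit _)) (trans (cong bool
          (trans (sym (FP.finToFun-funToFin (values i) k))
            (trans (cong (λ c → finToFun c k) eq) (FP.finToFun-funToFin (values j) k)))) (bool-bit _))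
        same-point : ∀ k → point i k xor point j k ≡ false
        same-point = ker _ (All.tabulate λ {F} F∈ → trans (All.lookup lin F∈ _ _)
          (trans (cong (_xor F (point j)) (subst (λ H → H (point i) ≡ H (point j)) (sym (lookup-index F∈)) (same-value (Any.index F∈))))
            (xor-same (F (point j)))))
        same-digit : ∀ k → finToFun {2} {m} i k ≡ finToFun j k
        same-digit k = trans (sym (bit-bool _)) (trans (cong bit (xor-false⇒≡ _ _ (same-point k))) (bit-bool _))

-- Finite subsets and reachability.

elements : ∀ {n} → Subset n → List (Fin n)
elements V.[] = []
elements (true V.∷ X) = zero ∷ map suc (elements X)
elements (false V.∷ X) = map suc (elements X)

length-elements : ∀ {n} (X : Subset n) → length (elements X) ≡ ∣ X ∣
length-elements V.[] = refl
length-elements (true V.∷ X) = cong suc (trans (length-map suc (elements X)) (length-elements X))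
length-elements (false V.∷ X) = trans (length-map suc (elements X)) (length-elements X)

∈-elements : ∀ {n} {X : Subset n} {e} → e ∈ X → e ∈ₗ elements X
∈-elements V.here = here refl
∈-elements {X = true V.∷ X} (V.there e∈) = there (∈-map⁺ suc (∈-elements e∈))
∈-elements {X = false V.∷ X} (V.there e∈) = ∈-map⁺ suc (∈-elements e∈)

-- The set grows by one element at a time along a step of `R` that leaves it. The bound
-- `n ≤ ∣ S ∣ + k` makes `k` enough fuel, as `∣ S ∣` never exceeds `n`.
reachable : ∀ {n ℓ} (R : Fin n → Fin n → Set ℓ) → (∀ x y → Dec (R x y)) → (S₀ : Subset n) →
  ∃[ S ] (S₀ ⊆ S × (∀ {x} → x ∈ S → ∃[ s ] (s ∈ S₀ × Star R s x)) × (∀ {x y} → x ∈ S → R x y → y ∈ S))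
reachable {n} R R? S₀ = grow n S₀ (ℕ.m≤n+m n _) (λ x∈ → x∈) (λ x∈ → _ , x∈ , ε)
  where
    grow : ∀ k S → n ≤ ∣ S ∣ + k → S₀ ⊆ S → (∀ {x} → x ∈ S → ∃[ s ] (s ∈ S₀ × Star R s x)) →
      ∃[ S ] (S₀ ⊆ S × (∀ {x} → x ∈ S → ∃[ s ] (s ∈ S₀ × Star R s x)) × (∀ {x y} → x ∈ S → R x y → y ∈ S))
    grow k S bound S₀⊆S reach
      with FP.any? (λ x → FP.any? (λ y → (x ∈? S) ×-dec (¬? (y ∈? S)) ×-dec R? x y))
    ... | no none = S , S₀⊆S , reach , closed
      where
        closed : ∀ {x y} → x ∈ S → R x y → y ∈ S
        closed {x} {y} x∈ r with y ∈? S
        ... | yes y∈ = y∈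
        ... | no y∉ = ⊥-elim (none (x , y , x∈ , y∉ , r))
    ... | yes (x , y , x∈ , y∉ , r) = enlarge k bound
      where
        S′ = S ∪ ⁅ y ⁆
        larger : ∣ S ∣ < ∣ S′ ∣
        larger = p⊂q⇒∣p∣<∣q∣ (p⊆p∪q ⁅ y ⁆ , y , x∈p∪q⁺ (inj₂ (x∈⁅x⁆ y)) , y∉)
        reach′ : ∀ {z} → z ∈ S′ → ∃[ s ] (s ∈ S₀ × Star R s z)
        reach′ z∈ with x∈p∪q⁻ S ⁅ y ⁆ z∈
        ... | inj₁ z∈S = reach z∈S
        ... | inj₂ z∈y rewrite x∈⁅y⁆⇒x≡y y z∈y with reach x∈
        ... | s , s∈ , path = s , s∈ , path ◅◅ (r ◅ ε)
        enlarge : ∀ k → n ≤ ∣ S ∣ + k → _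
        enlarge zero bound = ⊥-elim (ℕ.<-irrefl refl
          (ℕ.<-≤-trans larger (ℕ.≤-trans (∣p∣≤n S′) (subst (n ≤_) (ℕ.+-identityʳ _) bound))))
        enlarge (suc k) bound = grow k S′
          (ℕ.≤-trans (subst (n ≤_) (ℕ.+-suc ∣ S ∣ k) bound) (ℕ.+-monoˡ-≤ k larger))
          (p⊆p∪q ⁅ y ⁆ ∘ S₀⊆S) reach′

-- Rotations, sublists and runs of one colour.

++-compare : ∀ (as : List A) {bs cs ds} → as ++ bs ≡ cs ++ ds →
  (∃[ ks ] (cs ≡ as ++ ks × bs ≡ ks ++ ds)) ⊎ (∃[ ks ] (as ≡ cs ++ ks × ds ≡ ks ++ bs))
++-compare [] {cs = cs} eq = inj₁ (cs , refl , eq)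
++-compare (a ∷ as) {cs = []} eq = inj₂ (a ∷ as , refl , sym eq)
++-compare (a ∷ as) {cs = c ∷ cs} eq with ∷-injective eq
... | refl , eq′ with ++-compare as {cs = cs} eq′
... | inj₁ (ks , refl , q) = inj₁ (ks , refl , q)
... | inj₂ (ks , refl , q) = inj₂ (ks , refl , q)

-- `CyclicInterval` allows a single rotation of the given list, while the construction rotates
-- twice: once to bring `d₀` to the front, once to bring an arc to the end.
rotate-again : ∀ {xs : List A} ys zs ms ts → xs ≡ ys ++ zs → zs ++ ys ≡ ms ++ ts →
  ∃₂ λ ys′ zs′ → xs ≡ ys′ ++ zs′ × zs′ ++ ys′ ≡ ts ++ ms
rotate-again ys zs ms ts refl eq with ++-compare zs {cs = ms} eq
... | inj₁ (ks , refl , refl) = ks , ts ++ zs , ++-assoc ks ts zs , ++-assoc ts zs ks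
... | inj₂ (ks , refl , refl) = ys ++ ms , ks , sym (++-assoc ys ms ks) , sym (++-assoc ks ys ms)

⊑-++⁻ : ∀ {ws : List A} xs {ys} → ws ⊑ xs ++ ys → ∃₂ λ us vs → ws ≡ us ++ vs × us ⊑ xs × vs ⊑ ys
⊑-++⁻ [] s = [] , _ , refl , [] , s
⊑-++⁻ (x ∷ xs) (_ ∷ʳ s) with ⊑-++⁻ xs s
... | us , vs , eq , s₁ , s₂ = us , vs , eq , x ∷ʳ s₁ , s₂
⊑-++⁻ (x ∷ xs) (refl ∷ s) with ⊑-++⁻ xs s
... | us , vs , refl , s₁ , s₂ = x ∷ us , vs , refl , refl ∷ s₁ , s₂

initial-run : ∀ (χ : A → Bool) c ys → ∃₂ λ R ts →
  ys ≡ R ++ ts × All (λ x → χ x ≡ c) R × (ts ≡ [] ⊎ ∃₂ λ y ts′ → ts ≡ y ∷ ts′ × χ y ≢ c)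
initial-run χ c [] = [] , [] , refl , [] , inj₁ refl
initial-run χ c (y ∷ ys) with χ y ≟ᵇ c
... | no y≢ = [] , y ∷ ys , refl , [] , inj₂ (y , ys , refl , y≢)
... | yes y≡ with initial-run χ c ys
... | R , ts , refl , allR , end = y ∷ R , ts , refl , y≡ ∷ allR , end

first-run : ∀ (χ : A → Bool) c ms → Any (λ x → χ x ≡ c) ms → ∃₂ λ us r → ∃₂ λ R ts →
  ms ≡ us ++ (r ∷ R) ++ ts × All (λ x → χ x ≢ c) us × All (λ x → χ x ≡ c) (r ∷ R) ×
  (ts ≡ [] ⊎ ∃₂ λ y ts′ → ts ≡ y ∷ ts′ × χ y ≢ c)
first-run χ c (x ∷ ms) some with χ x ≟ᵇ c
... | yes x≡ with initial-run χ c ms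
... | R , ts , refl , allR , end = [] , x , R , ts , refl , [] , x≡ ∷ allR , end
first-run χ c (x ∷ ms) (here x≡) | no x≢ = ⊥-elim (x≢ x≡)
first-run χ c (x ∷ ms) (there some) | no x≢ with first-run χ c ms some
... | us , r , R , ts , refl , allU , allR , end = x ∷ us , r , R , ts , refl , x≢ ∷ allU , allR , end

regroup : ∀ (pre us R₁ : List A) y R₂ T₁ t T₂ post →
  pre ++ (us ++ (R₁ ++ y ∷ R₂) ++ (T₁ ++ t ∷ T₂)) ++ post ≡
  (pre ++ us ++ R₁) ++ y ∷ (R₂ ++ T₁) ++ t ∷ (T₂ ++ post)
regroup (x ∷ pre) us R₁ y R₂ T₁ t T₂ post = cong (x ∷_) (regroup pre us R₁ y R₂ T₁ t T₂ post)
regroup [] (x ∷ us) R₁ y R₂ T₁ t T₂ post = cong (x ∷_) (regroup [] us R₁ y R₂ T₁ t T₂ post)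
regroup [] [] (x ∷ R₁) y R₂ T₁ t T₂ post = cong (x ∷_) (regroup [] [] R₁ y R₂ T₁ t T₂ post)
regroup [] [] [] y R₂ T₁ t T₂ post = cong (y ∷_)
  (trans (++-assoc R₂ (T₁ ++ t ∷ T₂) post)
    (trans (cong (R₂ ++_) (++-assoc T₁ (t ∷ T₂) post)) (sym (++-assoc R₂ T₁ _))))

-- Closed intervals of one colour in a non-crossing cyclic order.

module ClosedInterval {A : Set} (_∼_ : A → A → Set) (_∼?_ : ∀ x y → Dec (x ∼ y))
  (∼-sym : ∀ {x y} → x ∼ y → y ∼ x) (χ : A → Bool) (xs : List A)
  (χ-resp : ∀ {x y} → x ∈ₗ xs → y ∈ₗ xs → x ∼ y → χ x ≡ χ y)
  (noncrossing : ∀ {p q p′ q′} → p ∷ q ∷ p′ ∷ q′ ∷ [] ⊑ xs → p ∼ p′ → q ∼ q′ → χ p ≡ χ q)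
  (d₀ : A)
  where

  Closed : List A → Set
  Closed R = ∀ {r x} → r ∈ₗ R → x ∈ₗ xs → r ∼ x → x ∈ₗ R

  -- Keeping `d₀` in the prefix `us` ensures that it stays in the first part when the interval is
  -- split off.
  Result : Set
  Result = ∃₂ λ us r → ∃₂ λ R ts → xs ≡ us ++ (r ∷ R) ++ ts × d₀ ∈ₗ us ×
    (∃[ c ] All (λ x → χ x ≡ c) (r ∷ R)) × Closed (r ∷ R)

  -- A related `x` before `y` or after `t` would give the interleaved quadruple `x y m t` or
  -- `y m t x`, which forces `m` and `y` to have one colour. Being `y` or `t` itself is excluded by
  -- colour as well.
  confined : ∀ {pre y ms t post} → xs ≡ pre ++ y ∷ ms ++ t ∷ post → y ∼ t →
    ∀ {m x} → m ∈ₗ ms → χ m ≢ χ y → x ∈ₗ xs → m ∼ x → x ∈ₗ ms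
  confined {pre} {y} {ms} {t} {post} eq y∼t {m} {x} m∈ m≢y x∈ m∼x = at (∈-++⁻ pre (subst (x ∈ₗ_) eq x∈))
    where
      ∈xs : ∀ {z} → z ∈ₗ y ∷ ms ++ t ∷ post → z ∈ₗ xs
      ∈xs z∈ = subst (_ ∈ₗ_) (sym eq) (∈-++⁺ʳ pre z∈)
      m∈xs : m ∈ₗ xs
      m∈xs = ∈xs (there (∈-++⁺ˡ m∈))
      χm≡χx : χ m ≡ χ x
      χm≡χx = χ-resp m∈xs x∈ m∼x
      at : x ∈ₗ pre ⊎ x ∈ₗ y ∷ ms ++ t ∷ post → x ∈ₗ ms
      at (inj₁ x∈pre) = ⊥-elim (m≢y (trans χm≡χx (noncrossing
        (subst (_ ⊑_) (sym eq) (++⁺ (from∈ x∈pre) (refl ∷ ++⁺ (from∈ m∈) (refl ∷ minimum post)))) (∼-sym m∼x) y∼t)))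
      at (inj₂ (here refl)) = ⊥-elim (m≢y χm≡χx)
      at (inj₂ (there x∈)) with ∈-++⁻ ms x∈
      ... | inj₁ x∈ms = x∈ms
      ... | inj₂ (here refl) = ⊥-elim (m≢y (trans χm≡χx
              (sym (χ-resp (∈xs (here refl)) (∈xs (there (∈-++⁺ʳ ms (here refl)))) y∼t))))
      ... | inj₂ (there x∈post) = ⊥-elim (m≢y (sym (noncrossing
              (subst (_ ⊑_) (sym eq) (++⁺ˡ pre (refl ∷ ++⁺ (from∈ m∈) (refl ∷ from∈ x∈post)))) y∼t m∼x)))

  -- The first run of colour c inside ms is closed unless one of its elements r is related
  -- to a later t; then the elements of the other colour strictly between r and t are
  -- confined to that shorter segment, because they may not cross the pair r ∼ t.
  search : ∀ n c pre ms post → length ms ≤ n → xs ≡ pre ++ ms ++ post → d₀ ∈ₗ pre →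
    Any (λ x → χ x ≡ c) ms →
    (∀ {m x} → m ∈ₗ ms → χ m ≡ c → x ∈ₗ xs → m ∼ x → x ∈ₗ ms) → Result
  search n c pre ms post ≤n eq d₀∈ some conf with first-run χ c ms some
  ... | us , r , R , ts , refl , allU , allR , end
    with any? (λ x → any? (x ∼?_) ts) (r ∷ R)
  ... | no none = pre ++ us , r , R , ts ++ post ,
      trans eq (trans (cong (pre ++_) (trans (++-assoc us ((r ∷ R) ++ ts) post) (cong (us ++_) (++-assoc (r ∷ R) ts post))))
        (sym (++-assoc pre us _))) ,
      ∈-++⁺ˡ d₀∈ , (c , allR) , closed
    where
      closed : Closed (r ∷ R)
      closed {y} {x} y∈ x∈ y∼x
        with ∈-++⁻ us (conf (∈-++⁺ʳ us (∈-++⁺ˡ y∈)) (All.lookup allR y∈) x∈ y∼x)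
      ... | inj₁ x∈us = ⊥-elim (All.lookup allU x∈us
              (trans (sym (χ-resp (subst (y ∈ₗ_) (sym eq) (∈-++⁺ʳ pre (∈-++⁺ˡ (∈-++⁺ʳ us (∈-++⁺ˡ y∈))))) x∈ y∼x))
                (All.lookup allR y∈)))
      ... | inj₂ x∈R′ with ∈-++⁻ (r ∷ R) x∈R′
      ... | inj₁ x∈R = x∈R
      ... | inj₂ x∈ts = ⊥-elim (none (lose∈ y∈ (lose∈ x∈ts y∼x)))
  search n c pre .(us ++ (r ∷ R) ++ ts) post ≤n eq d₀∈ some conf
    | us , r , R , ts , refl , allU , allR , end | yes found
    with find found
  ... | y , y∈ , found′ with find found′
  ... | t , t∈ , y∼t = narrow n ≤n (∈-∃++ y∈) (∈-∃++ t∈) end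
    where
      ∈xs : ∀ {x} → x ∈ₗ (r ∷ R) ++ ts → x ∈ₗ xs
      ∈xs x∈ = subst (_ ∈ₗ_) (sym eq) (∈-++⁺ʳ pre (∈-++⁺ˡ (∈-++⁺ʳ us x∈)))
      χy : χ y ≡ c
      χy = All.lookup allR y∈
      χt : χ t ≡ c
      χt = trans (sym (χ-resp (∈xs (∈-++⁺ˡ y∈)) (∈xs (∈-++⁺ʳ (r ∷ R) t∈)) y∼t)) χy
      narrow : ∀ n → length (us ++ (r ∷ R) ++ ts) ≤ n →
        (∃₂ λ R₁ R₂ → r ∷ R ≡ R₁ ++ [ y ] ++ R₂) → (∃₂ λ T₁ T₂ → ts ≡ T₁ ++ [ t ] ++ T₂) →
        (ts ≡ [] ⊎ ∃₂ λ y ts′ → ts ≡ y ∷ ts′ × χ y ≢ c) → Result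
      narrow n ≤n _ ([] , T₂ , tsEq) (inj₁ tsNil) with trans (sym tsEq) tsNil
      ... | ()
      narrow n ≤n _ (_ ∷ T₁ , T₂ , tsEq) (inj₁ tsNil) with trans (sym tsEq) tsNil
      ... | ()
      narrow n ≤n _ ([] , T₂ , tsEq) (inj₂ (z , _ , tsEq′ , z≢)) with trans (sym tsEq) tsEq′
      ... | refl = ⊥-elim (z≢ χt)
      -- The list `ts` starts with `z` of the other colour and `t` has colour `c`, so `z` lies
      -- strictly before `t`; the shorter segment does contain the other colour.
      narrow n ≤n (R₁ , R₂ , rEq) (z₁ ∷ T₁ , T₂ , tsEq) (inj₂ (z , _ , tsEq′ , z≢)) with trans (sym tsEq) tsEq′
      ... | refl = descend n ≤n
        where
          msEq : us ++ (r ∷ R) ++ ts ≡ us ++ (R₁ ++ y ∷ R₂) ++ ((z ∷ T₁) ++ t ∷ T₂)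
          msEq = cong (us ++_) (cong₂ _++_ rEq tsEq)
          eq′ : xs ≡ (pre ++ us ++ R₁) ++ y ∷ (R₂ ++ z ∷ T₁) ++ t ∷ (T₂ ++ post)
          eq′ = trans eq (trans (cong (λ ms → pre ++ ms ++ post) msEq) (regroup pre us R₁ y R₂ (z ∷ T₁) t T₂ post))
          shorter : length (R₂ ++ z ∷ T₁) < length (us ++ (r ∷ R) ++ ts)
          shorter = subst (λ ms → length (R₂ ++ z ∷ T₁) < length ms) (sym msEq)
            (length-mono-≤ {as = y ∷ R₂ ++ z ∷ T₁} (++⁺ˡ us (++⁺ (++⁺ˡ R₁ Sub.⊆-refl) (++⁺ʳ (t ∷ T₂) Sub.⊆-refl))))
          descend : ∀ n → length (us ++ (r ∷ R) ++ ts) ≤ n → Result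
          descend zero ≤0 with ℕ.<-≤-trans shorter ≤0
          ... | ()
          descend (suc n) ≤n = search n (not c) ((pre ++ us ++ R₁) ++ [ y ]) (R₂ ++ z ∷ T₁) (t ∷ T₂ ++ post)
            (ℕ.≤-pred (ℕ.<-≤-trans shorter ≤n))
            (trans eq′ (sym (++-assoc (pre ++ us ++ R₁) [ y ] _)))
            (∈-++⁺ˡ (∈-++⁺ˡ d₀∈))
            (++⁺ᵃ R₂ (here (≢⇒≡not z≢)))
            (λ m∈ χm → confined eq′ y∼t m∈ (λ χm≡ → not-¬ refl (trans (sym χy) (trans (sym χm≡) χm))))

  -- With `d₀` in front, segments of the tail are arcs of the cyclic order that avoid `d₀`. Elements
  -- coloured unlike `d₀` are confined to the tail from the outset, because related elements share
  -- their colour.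
  closed-interval : ∀ xs′ → xs ≡ d₀ ∷ xs′ → Any (λ x → χ x ≢ χ d₀) xs′ → Result
  closed-interval xs′ eq some = search (length xs′) (not (χ d₀)) [ d₀ ] xs′ [] ℕ.≤-refl
    (trans eq (cong (d₀ ∷_) (sym (++-identityʳ xs′)))) (here refl) (Any.map ≢⇒≡not some) conf
    where
      conf : ∀ {m x} → m ∈ₗ xs′ → χ m ≡ not (χ d₀) → x ∈ₗ xs → m ∼ x → x ∈ₗ xs′
      conf {m} {x} m∈ χm x∈ m∼x with subst (x ∈ₗ_) eq x∈
      ... | there x∈′ = x∈′
      ... | here refl = ⊥-elim (not-¬ refl (trans (sym (χ-resp (subst (m ∈ₗ_) (sym eq) (there m∈)) x∈ m∼x)) χm))

-- Darts, face colourings and their coboundaries.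

∈⇒lookup : ∀ {n} {X : Subset n} {e} → e ∈ X → lookup X e ≡ true
∈⇒lookup = []=⇒lookup

∉⇒lookup : ∀ {n} {X : Subset n} {e} → e ∉ X → lookup X e ≡ false
∉⇒lookup {X = X} {e} e∉ with lookup X e in eq
... | false = refl
... | true = ⊥-elim (e∉ (lookup⇒[]= e X eq))

does-true : ∀ {P : Set} (P? : Dec P) → does P? ≡ true → P
does-true (yes p) _ = p

_≟ᵈ_ : ∀ {n} → DecidableEquality (Dart n)
_≟ᵈ_ = ≡-dec _≟_ _≟ᵇ_

module Graph (G : RibbonGraph) where
  open RibbonGraph G
  open RG G

  vt : Dart nE → Fin nV
  vt d = proj₁ (rot-cover d)

  ∈-vt : ∀ {d u} → vt d ≡ u → d ∈ₗ rot u
  ∈-vt {d} refl = proj₂ (rot-cover d)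

  vt-unique : ∀ {d u} → d ∈ₗ rot u → vt d ≡ u
  vt-unique {d} d∈ = rot-disj d _ _ (∈-vt refl) d∈

  At : Fin nE → Fin nV → Set
  At e u = ∃[ b ] vt (e , b) ≡ u

  At? : ∀ e u → Dec (At e u)
  At? e u with vt (e , false) ≟ u | vt (e , true) ≟ u
  ... | yes p | _ = yes (false , p)
  ... | no _ | yes q = yes (true , q)
  ... | no ¬p | no ¬q = no λ { (false , p) → ¬p p ; (true , q) → ¬q q }

  At-≢⇒not : ∀ {e u b} → vt (e , b) ≢ u → At e u → vt (e , not b) ≡ u
  At-≢⇒not {b = false} u≢ (false , q) = ⊥-elim (u≢ q)
  At-≢⇒not {b = false} u≢ (true , q) = q
  At-≢⇒not {b = true} u≢ (false , q) = q
  At-≢⇒not {b = true} u≢ (true , q) = ⊥-elim (u≢ q)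

  At⇒Any : ∀ {e u} → At e u → Any (λ d → proj₁ d ≡ e) (rot u)
  At⇒Any (b , p) = lose∈ (∈-vt p) refl

  Inc⇒At : ∀ {X u} → Inc X u → ∃[ e ] (e ∈ X × At e u)
  Inc⇒At any with find any
  ... | (e , b) , d∈ , e∈ = e , e∈ , b , vt-unique d∈

  At⇒Inc : ∀ {X e u} → e ∈ X → At e u → Inc X u
  At⇒Inc e∈ (b , p) = lose∈ (∈-vt p) e∈

  Within : (Fin nV → Set) → E → Fin nV → Fin nV → Set
  Within K Z u w = ∃₂ λ e b → e ∈ Z × vt (e , b) ≡ u × vt (e , not b) ≡ w × K u × K w

  Step⇒Within : ∀ {X u w} → Step X u w → Within (λ _ → ⊤) X u w
  Step⇒Within (e , e∈ , inj₁ (p , q)) = e , false , e∈ , vt-unique p , vt-unique q , tt , tt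
  Step⇒Within (e , e∈ , inj₂ (p , q)) = e , true , e∈ , vt-unique p , vt-unique q , tt , tt

  edge⇒Step : ∀ {X e} b → e ∈ X → Step X (vt (e , b)) (vt (e , not b))
  edge⇒Step {e = e} false e∈ = e , e∈ , inj₁ (∈-vt refl , ∈-vt refl)
  edge⇒Step {e = e} true e∈ = e , e∈ , inj₂ (∈-vt refl , ∈-vt refl)

  edge-ends : ∀ {X e u w} → e ∈ X → At e u → At e w → Star (Step X) u w
  edge-ends {e = e} {w = w} e∈ (b , refl) at with vt (e , b) ≟ w
  ... | yes refl = ε
  ... | no u≢w = subst (Step _ _) (At-≢⇒not u≢w at) (edge⇒Step b e∈) ◅ ε

  -- A colouring ψ in Inv X is constant on boundary components; δ X ψ is the set of
  -- edges of X whose two sides get different colours.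
  Inv : E → (Pt → Bool) → Set
  Inv X ψ = ∀ p q → BdAdj X p q → ψ p ≡ ψ q

  δ : E → (Pt → Bool) → Fin nE → Bool
  δ X ψ e = lookup X e ∧ (ψ ((e , false) , false) xor ψ ((e , false) , true))

  δᵈ : E → (Pt → Bool) → Dart nE → Bool
  δᵈ X ψ d = δ X ψ (proj₁ d)

  δ-∉ : ∀ {X ψ e} → e ∉ X → δ X ψ e ≡ false
  δ-∉ e∉ rewrite ∉⇒lookup e∉ = refl

  -- Sides are named looking out of the vertex, so it is the untwisted edge that joins left to
  -- right.
  opposite : Fin nE → Bool → Bool
  opposite e s = if twist e then s else not s

  along-edge : ∀ {X ψ e} → Inv X ψ → e ∈ X → ∀ b s → ψ ((e , b) , s) ≡ ψ ((e , not b) , opposite e s)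
  along-edge {e = e} inv e∈ b s with twist e in eq
  along-edge inv e∈ false s | true = inv _ _ (tw _ s e∈ eq)
  along-edge inv e∈ true s | true = sym (inv _ _ (tw _ s e∈ eq))
  along-edge inv e∈ false s | false = inv _ _ (untw _ s e∈ eq)
  along-edge {ψ = ψ} {e = e} inv e∈ true s | false = sym (trans (inv _ _ (untw _ (not s) e∈ eq)) (cong (λ s → ψ ((e , true) , s)) (not-involutive s)))

  -- Both ends of an edge show the same two boundary strands, possibly swapped, so the difference at
  -- the `true` end agrees with `δ`, which is read at the `false` end.
  across-dart : ∀ {X ψ} → Inv X ψ → ∀ {d} → proj₁ d ∈ X → ψ (d , true) xor ψ (d , false) ≡ δᵈ X ψ d
  across-dart {X} {ψ} inv {e , false} e∈ rewrite ∈⇒lookup e∈ = xor-comm (ψ ((e , false) , true)) _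
  across-dart {X} {ψ} inv {e , true} e∈ with twist e in eq
  ... | true rewrite ∈⇒lookup e∈ | inv _ _ (tw e true e∈ eq) | inv _ _ (tw e false e∈ eq) = xor-comm (ψ ((e , true) , true)) _
  ... | false rewrite ∈⇒lookup e∈ | inv _ _ (untw e true e∈ eq) | inv _ _ (untw e false e∈ eq) = refl

  from-true : ∀ {X ψ} → Inv X ψ → ∀ {d} → proj₁ d ∈ X → ψ (d , false) ≡ ψ (d , true) xor δᵈ X ψ d
  from-true {X} {ψ} inv {d} e∈ with across-dart inv e∈
  ... | eq rewrite sym eq = trans (cong (_xor ψ (d , false)) (sym (xor-same (ψ (d , true))))) (xor-assoc (ψ (d , true)) _ _)

  ∈rotIn : ∀ {X u d} → d ∈ₗ rotIn X u → proj₁ d ∈ X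
  ∈rotIn {X} {u} d∈ = proj₂ (∈-filter⁻ (λ d → proj₁ d ∈? X) {xs = rot u} d∈)

  -- An arc of the vertex boundary preserves the colour and passing a dart changes it by `δ` of its
  -- edge; the colours around the vertex are partial sums.
  around : ∀ {X ψ} → Inv X ψ → ∀ {u} pre x rest as d ds → rotIn X u ≡ pre ++ x ∷ rest → x ∷ rest ≡ as ++ d ∷ ds →
    ψ (d , true) ≡ ψ (x , true) xor ⨁ as (δᵈ X ψ)
  around {ψ = ψ} inv pre x rest [] d ds eq refl = sym (xor-identityʳ _)
  around {X} {ψ} inv {u} pre x (y ∷ rest) (_ ∷ as) d ds eq eq′ with ∷-injective eq′
  ... | refl , eq″ = begin
      ψ (d , true)                                            ≡⟨ around inv (pre ++ [ x ]) y rest as d ds (trans eq (sym (++-assoc pre [ x ] _))) eq″ ⟩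
      ψ (y , true) xor ⨁ as (δᵈ X ψ)                          ≡⟨ cong (_xor ⨁ as (δᵈ X ψ)) (sym (inv _ _ (vtx u x y (inj₁ (pre , rest , eq))))) ⟩
      ψ (x , false) xor ⨁ as (δᵈ X ψ)                         ≡⟨ cong (_xor ⨁ as (δᵈ X ψ)) (from-true inv (∈rotIn {u = u} (subst (x ∈ₗ_) (sym eq) (∈-++⁺ʳ pre (here refl))))) ⟩
      (ψ (x , true) xor δᵈ X ψ x) xor ⨁ as (δᵈ X ψ)           ≡⟨ xor-assoc (ψ (x , true)) _ _ ⟩
      ψ (x , true) xor (δᵈ X ψ x xor ⨁ as (δᵈ X ψ))           ∎
    where open ≡-Reasoning
  around inv pre x [] (_ ∷ []) d ds eq ()
  around inv pre x [] (_ ∷ _ ∷ _) d ds eq ()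

  ⨁-rotIn : ∀ {X ψ} ds → ⨁ (filter (λ d → proj₁ d ∈? X) ds) (δᵈ X ψ) ≡ ⨁ ds (δᵈ X ψ)
  ⨁-rotIn {X} {ψ} ds = ⨁-filter _ ds (δᵈ X ψ) (λ d → δ-∉ {ψ = ψ})

  -- The sum runs over the full rotation `rot u` instead of `rotIn X u`, since darts off `X`
  -- contribute nothing. This makes the darts crossed by a curve independent of `X`, so that one
  -- curve can be evaluated in several subgraphs.
  base : ∀ {X ψ} → Inv X ψ → ∀ u → ∃[ b ] (∀ as {d} ds → rot u ≡ as ++ d ∷ ds → proj₁ d ∈ X →
    ψ (d , true) ≡ b xor ⨁ as (δᵈ X ψ))
  base {X} {ψ} inv u with rotIn X u in eqIn
  -- No dart of `X` is at `u`, so any constant will do.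
  ... | [] = false , λ as {d} ds eq d∈ → ⊥-elim (nil (subst (d ∈ₗ_) eqIn
             (∈-filter⁺ (λ d → proj₁ d ∈? X) (subst (d ∈ₗ_) (sym eq) (∈-++⁺ʳ as (here refl))) d∈)))
    where
      nil : ∀ {d : Dart nE} → d ∉ₗ []
      nil ()
  ... | x ∷ rest = ψ (x , true) , λ as {d} ds eq d∈ → trans
          (around inv {u} [] x rest (filter (λ d → proj₁ d ∈? X) as) d _ eqIn
            (trans (sym eqIn) (trans (cong (filter _) eq) (trans (filter-++ _ as (d ∷ ds))
              (cong (filter _ as ++_) (filter-accept (λ d → proj₁ d ∈? X) d∈))))))
          (cong (ψ (x , true) xor_) (⨁-rotIn {ψ = ψ} as))

  ∂ : (Fin nE → Bool) → Fin nV → Bool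
  ∂ α u = ⨁ (rot u) (α ∘ proj₁)

  snoc-view : ∀ {A : Set} (x : A) xs → ∃₂ λ ys y → x ∷ xs ≡ ys ++ [ y ]
  snoc-view x [] = [] , x , refl
  snoc-view x (x′ ∷ xs) with snoc-view x′ xs
  ... | ys , y , eq = x ∷ ys , y , cong (x ∷_) eq

  wrap : ∀ {A : Set} {x : A} {xs ys y} → x ∷ xs ≡ ys ++ [ y ] → CycSucc (x ∷ xs) y x
  wrap {ys = []} refl = inj₂ (inj₂ (refl , refl))
  wrap {ys = z ∷ ys} eq with ∷-injective eq
  ... | refl , refl = inj₂ (inj₁ (ys , refl))

  -- Once around the vertex the colour is back at its initial value, so its changes add up to zero.
  ∂δ≡0 : ∀ {X ψ} → Inv X ψ → ∀ u → ∂ (δ X ψ) u ≡ false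
  ∂δ≡0 {X} {ψ} inv u = trans (sym (⨁-rotIn {X} {ψ} (rot u))) closes
    where
      closes : ⨁ (rotIn X u) (δᵈ X ψ) ≡ false
      closes with rotIn X u in eqIn
      ... | [] = refl
      ... | x ∷ rest with snoc-view x rest
      ... | ys , y , eq = begin
          ⨁ (x ∷ rest) (δᵈ X ψ)                  ≡⟨ cong (λ xs → ⨁ xs (δᵈ X ψ)) eq ⟩
          ⨁ (ys ++ [ y ]) (δᵈ X ψ)               ≡⟨ ⨁-++ ys [ y ] _ ⟩
          s xor (t xor false)                    ≡⟨ cong (s xor_) (xor-identityʳ t) ⟩
          s xor t                                ≡⟨ cancel (ψ (x , true)) s t turned ⟩
          false                                  ∎
        where
          open ≡-Reasoning
          s = ⨁ ys (δᵈ X ψ)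
          t = δᵈ X ψ y
          y∈ : proj₁ y ∈ X
          y∈ = ∈rotIn {u = u} (subst (y ∈ₗ_) (sym (trans eqIn eq)) (∈-++⁺ʳ ys (here refl)))
          turned : ψ (x , true) ≡ (ψ (x , true) xor s) xor t
          turned = trans (sym (inv _ _ (vtx u y x (subst (λ xs → CycSucc xs y x) (sym eqIn) (wrap eq)))))
            (trans (from-true inv y∈) (cong (_xor t) (around inv {u} [] x rest ys y [] eqIn eq)))
          cancel : ∀ a s t → a ≡ (a xor s) xor t → s xor t ≡ false
          cancel false s t eq = sym eq
          cancel true false false eq = refl
          cancel true true true eq = refl

  -- In the order of the rotation the `true` side of a dart precedes it and the `false` side follows
  -- it; only in the second case has the dart itself been passed.
  side : Dart nE → Bool → List (Dart nE)
  side d true = []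
  side d false = [ d ]

  offset : ∀ {X ψ} → Inv X ψ → ∀ {b as d} → proj₁ d ∈ X → ψ (d , true) ≡ b xor ⨁ as (δᵈ X ψ) →
    ∀ s → ψ (d , s) ≡ b xor ⨁ (as ++ side d s) (δᵈ X ψ)
  offset {X} {ψ} inv {b} {as} d∈ eq true = trans eq (cong (λ xs → b xor ⨁ xs (δᵈ X ψ)) (sym (++-identityʳ as)))
  offset {X} {ψ} inv {b} {as} {d} d∈ eq false = begin
      ψ (d , false)                                       ≡⟨ from-true inv d∈ ⟩
      ψ (d , true) xor t                                  ≡⟨ cong (_xor t) eq ⟩
      (b xor ⨁ as (δᵈ X ψ)) xor t                         ≡⟨ xor-assoc b _ _ ⟩
      b xor (⨁ as (δᵈ X ψ) xor t)                         ≡⟨ cong (λ t → b xor (⨁ as (δᵈ X ψ) xor t)) (sym (xor-identityʳ t)) ⟩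
      b xor (⨁ as (δᵈ X ψ) xor (t xor false))             ≡⟨ cong (b xor_) (sym (⨁-++ as [ d ] _)) ⟩
      b xor ⨁ (as ++ [ d ]) (δᵈ X ψ)                      ∎
    where
      open ≡-Reasoning
      t = δᵈ X ψ d

  -- Both points are measured from the start of `rot u`. The base colour and the darts common to the
  -- two prefixes occur twice and cancel, so no case distinction on the order of the points is
  -- required.
  turn : ∀ {u} d d′ s s′ → vt d ≡ u → vt d′ ≡ u → ∃[ M ] ((∀ {x} → x ∈ₗ M → vt x ≡ u) ×
    (∀ X ψ → Inv X ψ → proj₁ d ∈ X → proj₁ d′ ∈ X → ψ (d , s) xor ψ (d′ , s′) ≡ ⨁ M (δᵈ X ψ)))
  turn {u} d d′ s s′ at at′ with ∈-∃++ (∈-vt at) | ∈-∃++ (∈-vt at′)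
  ... | as , ds , eq | as′ , ds′ , eq′ = (as ++ side d s) ++ (as′ ++ side d′ s′) , M-at , M-sum
    where
      before : ∀ {as d ds} s → vt d ≡ u → rot u ≡ as ++ d ∷ ds → ∀ {x} → x ∈ₗ as ++ side d s → vt x ≡ u
      before {as} s at eq x∈ with ∈-++⁻ as x∈
      before s at eq x∈ | inj₁ x∈as = vt-unique (subst (_ ∈ₗ_) (sym eq) (∈-++⁺ˡ x∈as))
      before false at eq x∈ | inj₂ (here refl) = at
      M-at : ∀ {x} → x ∈ₗ (as ++ side d s) ++ (as′ ++ side d′ s′) → vt x ≡ u
      M-at x∈ with ∈-++⁻ (as ++ side d s) x∈
      ... | inj₁ x∈₁ = before s at eq x∈₁
      ... | inj₂ x∈₂ = before s′ at′ eq′ x∈₂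
      M-sum : ∀ X ψ → Inv X ψ → proj₁ d ∈ X → proj₁ d′ ∈ X →
        ψ (d , s) xor ψ (d′ , s′) ≡ ⨁ ((as ++ side d s) ++ (as′ ++ side d′ s′)) (δᵈ X ψ)
      M-sum X ψ inv d∈ d′∈ with base inv u
      ... | b , pot = begin
          ψ (d , s) xor ψ (d′ , s′)             ≡⟨ cong₂ _xor_ (offset inv {b} {as} d∈ (pot as ds eq d∈) s) (offset inv {b} {as′} d′∈ (pot as′ ds′ eq′ d′∈) s′) ⟩
          (b xor m) xor (b xor m′)              ≡⟨ xor-interchange b m b m′ ⟩
          (b xor b) xor (m xor m′)              ≡⟨ cong (_xor (m xor m′)) (xor-same b) ⟩
          m xor m′                              ≡⟨ sym (⨁-++ (as ++ side d s) _ _) ⟩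
          ⨁ ((as ++ side d s) ++ (as′ ++ side d′ s′)) (δᵈ X ψ) ∎
        where
          open ≡-Reasoning
          m = ⨁ (as ++ side d s) (δᵈ X ψ)
          m′ = ⨁ (as′ ++ side d′ s′) (δᵈ X ψ)

  -- Unlike in `turn`, each passed dart is listed exactly once: whether another dart lies in `bs`
  -- will decide the parity of a crossing.
  between : ∀ {u} as d bs d′ ds → rot u ≡ as ++ d ∷ bs ++ d′ ∷ ds →
    ∀ {X ψ} → Inv X ψ → proj₁ d ∈ X → proj₁ d′ ∈ X → ψ (d , false) xor ψ (d′ , true) ≡ ⨁ bs (δᵈ X ψ)
  between {u} as d bs d′ ds eq {X} {ψ} inv d∈ d′∈ with base inv u
  ... | b , pot = begin
      ψ (d , false) xor ψ (d′ , true)           ≡⟨ cong₂ _xor_ (offset inv {b} {as} d∈ (pot as _ eq d∈) false)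
                                                     (pot (as ++ d ∷ bs) ds (trans eq (sym (++-assoc as (d ∷ bs) _))) d′∈) ⟩
      (b xor m) xor (b xor ⨁ (as ++ d ∷ bs) δᵈ′) ≡⟨ cong (λ xs → (b xor m) xor (b xor ⨁ xs δᵈ′)) (sym (++-assoc as [ d ] bs)) ⟩
      (b xor m) xor (b xor ⨁ ((as ++ [ d ]) ++ bs) δᵈ′) ≡⟨ cong (λ t → (b xor m) xor (b xor t)) (⨁-++ (as ++ [ d ]) bs _) ⟩
      (b xor m) xor (b xor (m xor n))           ≡⟨ cong ((b xor m) xor_) (sym (xor-assoc b m n)) ⟩
      (b xor m) xor ((b xor m) xor n)           ≡⟨ sym (xor-assoc (b xor m) _ n) ⟩
      ((b xor m) xor (b xor m)) xor n           ≡⟨ cong (_xor n) (xor-same (b xor m)) ⟩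
      n                                         ∎
    where
      open ≡-Reasoning
      δᵈ′ = δᵈ X ψ
      m = ⨁ (as ++ [ d ]) (δᵈ X ψ)
      n = ⨁ bs (δᵈ X ψ)

  -- The points p and q are joined by a curve that runs beside edges of Z
  -- and crosses the darts M, all at vertices of K.
  Curve : (Fin nV → Set) → E → Pt → Pt → Set
  Curve K Z p q = ∃[ M ] ((∀ {x} → x ∈ₗ M → K (vt x)) ×
    (∀ X ψ → Z ⊆ X → Inv X ψ → ψ p xor ψ q ≡ ⨁ M (δᵈ X ψ)))

  xor-telescope : ∀ a b c → (a xor b) xor (b xor c) ≡ a xor c
  xor-telescope a b c = trans (xor-assoc a b (b xor c))
    (cong (a xor_) (trans (sym (xor-assoc b b c)) (cong (_xor c) (xor-same b))))

  curve-turn : ∀ {K : Fin nV → Set} {Z : E} {u} → K u → ∀ d d′ s s′ → vt d ≡ u → vt d′ ≡ u →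
    proj₁ d ∈ Z → proj₁ d′ ∈ Z → Curve K Z (d , s) (d′ , s′)
  curve-turn {K} {Z} {u} Ku d d′ s s′ at at′ d∈ d′∈ = localise (turn d d′ s s′ at at′)
    where
      localise : ∃[ M ] ((∀ {x} → x ∈ₗ M → vt x ≡ u) × (∀ X ψ → Inv X ψ → proj₁ d ∈ X → proj₁ d′ ∈ X →
        ψ (d , s) xor ψ (d′ , s′) ≡ ⨁ M (δᵈ X ψ))) → Curve K Z (d , s) (d′ , s′)
      localise (M , M-at , M-sum) = M , (λ x∈ → subst K (sym (M-at x∈)) Ku) ,
        λ X ψ Z⊆X inv → M-sum X ψ inv (Z⊆X d∈) (Z⊆X d′∈)

  curve-trans : ∀ {K Z p q r} → Curve K Z p q → Curve K Z q r → Curve K Z p r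
  curve-trans {K} {Z} {p} {q} {r} (M , M-at , M-sum) (N , N-at , N-sum) = M ++ N , at-K , sums
    where
      at-K : ∀ {x} → x ∈ₗ M ++ N → K (vt x)
      at-K x∈ with ∈-++⁻ M x∈
      ... | inj₁ x∈M = M-at x∈M
      ... | inj₂ x∈N = N-at x∈N
      sums : ∀ X ψ → Z ⊆ X → Inv X ψ → ψ p xor ψ r ≡ ⨁ (M ++ N) (δᵈ X ψ)
      sums X ψ Z⊆X inv = trans (sym (xor-telescope (ψ p) (ψ q) (ψ r)))
        (trans (cong₂ _xor_ (M-sum X ψ Z⊆X inv) (N-sum X ψ Z⊆X inv)) (sym (⨁-++ M N (δᵈ X ψ))))

  curve-edge : ∀ {K : Fin nV → Set} {Z e} → e ∈ Z → ∀ b s → Curve K Z ((e , b) , s) ((e , not b) , opposite e s)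
  curve-edge {e = e} e∈ b s = [] , (λ ()) , λ X ψ Z⊆X inv →
    trans (cong (_xor ψ ((e , not b) , opposite e s)) (along-edge inv (Z⊆X e∈) b s)) (xor-same (ψ ((e , not b) , opposite e s)))

  curve-sym : ∀ {K Z p q} → Curve K Z p q → Curve K Z q p
  curve-sym {p = p} {q} (M , M-at , M-sum) = M , M-at , λ X ψ Z⊆X inv → trans (xor-comm (ψ q) (ψ p)) (M-sum X ψ Z⊆X inv)

  walk : ∀ {K Z u w} → Star (Within K Z) u w → K u → ∀ d d′ s s′ → vt d ≡ u → vt d′ ≡ w →
    proj₁ d ∈ Z → proj₁ d′ ∈ Z → Curve K Z (d , s) (d′ , s′)
  walk ε Ku d d′ s s′ at at′ d∈ d′∈ = curve-turn Ku d d′ s s′ at at′ d∈ d′∈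
  walk {K} {Z} (_◅_ {j = v} (e , b , e∈ , at₁ , at₂ , _ , Kv) path) Ku d d′ s s′ at at′ d∈ d′∈ =
    curve-trans {K} {Z} {d , s} {(e , b) , false} {d′ , s′} (curve-turn Ku d (e , b) s false at at₁ d∈ e∈)
      (curve-trans {K} {Z} {(e , b) , false} {(e , not b) , opposite e false} {d′ , s′} (curve-edge {K} e∈ b false)
        (walk path Kv (e , not b) d′ (opposite e false) s′ at₂ at′ e∈ d′∈))

  -- Boundaries of chains, pieces at a vertex, and closed curves.

  indicator : Fin nE → Fin nE → Bool
  indicator e x = does (x ≟ e)

  indicator-darts : ∀ e d → indicator e (proj₁ d) ≡ does (d ≟ᵈ (e , false)) xor does (d ≟ᵈ (e , true))
  indicator-darts e (x , b) with x ≟ e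
  indicator-darts e (x , false) | yes refl = refl
  indicator-darts e (x , true) | yes refl = refl
  indicator-darts e (x , b) | no _ = refl

  count-dart : ∀ d u → ⨁ (rot u) (λ x → does (x ≟ᵈ d)) ≡ does (vt d ≟ u)
  count-dart d u with vt d ≟ u
  ... | yes at = ⨁-∈ _≟ᵈ_ (rot-unique u) (∈-vt at)
  ... | no ¬at = ⨁-∉ _≟ᵈ_ (rot u) d (¬at ∘ vt-unique)

  ∂-indicator : ∀ e b u → ∂ (indicator e) u ≡ does (vt (e , b) ≟ u) xor does (vt (e , not b) ≟ u)
  ∂-indicator e b u = trans (⨁-cong (rot u) (λ d _ → indicator-darts e d)) (trans (⨁-xor (rot u) _ _)
    (trans (cong₂ _xor_ (count-dart (e , false) u) (count-dart (e , true) u)) (order b)))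
    where
      order : ∀ b → does (vt (e , false) ≟ u) xor does (vt (e , true) ≟ u) ≡ does (vt (e , b) ≟ u) xor does (vt (e , not b) ≟ u)
      order false = refl
      order true = xor-comm (does (vt (e , false) ≟ u)) _

  ∂-xor : ∀ α β u → ∂ (λ e → α e xor β e) u ≡ ∂ α u xor ∂ β u
  ∂-xor α β u = ⨁-xor (rot u) (α ∘ proj₁) (β ∘ proj₁)

  indicator-true : ∀ {e x} → indicator e x ≡ true → x ≡ e
  indicator-true {e} {x} = does-true (x ≟ e)

  xor-true : ∀ a {b} → a xor b ≡ true → a ≡ true ⊎ b ≡ true
  xor-true true _ = inj₁ refl
  xor-true false eq = inj₂ eq

  -- Each edge contributes its two ends and inner vertices cancel modulo 2. Edges traversed twice
  -- cancel too, so the chain may be smaller than the walk.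
  path-chain : ∀ {K Z u w} → Star (Within K Z) u w →
    ∃[ α ] ((∀ {e} → α e ≡ true → e ∈ Z × ∀ b → K (vt (e , b))) ×
      (∀ x → ∂ α x ≡ does (u ≟ x) xor does (w ≟ x)))
  path-chain {u = u} ε = (λ _ → false) , (λ ()) , λ x → trans (⨁-zero (rot x) (λ _ _ → refl)) (sym (xor-same (does (u ≟ x))))
  path-chain {K} {w = w} ((e , b , e∈ , refl , refl , Ku , Kv) ◅ path) with path-chain path
  ... | α , supp , bd = (λ x → indicator e x xor α x) , supp′ , bd′
    where
      ends : ∀ b′ → K (vt (e , b′))
      ends b′ with b′ ≟ᵇ b
      ... | yes refl = Ku
      ... | no b′≢b rewrite ≢⇒≡not b′≢b = Kv
      supp′ : ∀ {x} → indicator e x xor α x ≡ true → x ∈ _ × ∀ b → K (vt (x , b))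
      supp′ {x} eq with xor-true (indicator e x) eq
      ... | inj₂ αx = supp αx
      ... | inj₁ ix with indicator-true {e} {x} ix
      ... | refl = e∈ , ends
      bd′ : ∀ x → ∂ (λ x → indicator e x xor α x) x ≡ does (vt (e , b) ≟ x) xor does (w ≟ x)
      bd′ x = trans (∂-xor (indicator e) α x) (trans (cong₂ _xor_ (∂-indicator e b x) (bd x))
        (xor-telescope (does (vt (e , b) ≟ x)) (does (vt (e , not b) ≟ x)) (does (w ≟ x))))

  -- The classes of Star (Linked Z w) are the edge sets of the pieces into which
  -- the subgraph Z falls apart when it is cut at w.
  Linked : E → Fin nV → Fin nE → Fin nE → Set
  Linked Z w e e′ = e ∈ Z × e′ ∈ Z × ∃[ u ] (u ≢ w × At e u × At e′ u)

  Linked? : ∀ Z w e e′ → Dec (Linked Z w e e′)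
  Linked? Z w e e′ = (e ∈? Z) ×-dec (e′ ∈? Z) ×-dec FP.any? (λ u → ¬? (u ≟ w) ×-dec At? e u ×-dec At? e′ u)

  Linked-sym : ∀ {Z w e e′} → Linked Z w e e′ → Linked Z w e′ e
  Linked-sym (e∈ , e′∈ , u , u≢w , at , at′) = e′∈ , e∈ , u , u≢w , at′ , at

  piece-sym : ∀ {Z w e e′} → Star (Linked Z w) e e′ → Star (Linked Z w) e′ e
  piece-sym = Star.reverse Linked-sym

  piece-mono : ∀ {Z Z′ w e e′} → Z ⊆ Z′ → Star (Linked Z w) e e′ → Star (Linked Z′ w) e e′
  piece-mono Z⊆Z′ = Star.map (λ { (e∈ , e′∈ , r) → Z⊆Z′ e∈ , Z⊆Z′ e′∈ , r })

  loop-isolated : ∀ {Z w e e′} → (∀ b → vt (e , b) ≡ w) → Star (Linked Z w) e e′ → e ≡ e′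
  loop-isolated loop ε = refl
  loop-isolated loop ((_ , _ , u , u≢w , (b , at) , _) ◅ _) = ⊥-elim (u≢w (trans (sym at) (loop b)))

  -- A closed curve that leaves w through d₁ and comes back to w through d₂ without meeting w
  -- in between: its chain α of edges, and the darts M that a parallel curve crosses away from w.
  record Lap (Z : E) (w : Fin nV) (d₁ d₂ : Dart nE) : Set where
    field
      α       : Fin nE → Bool
      α⊆Z     : ∀ {e} → α e ≡ true → e ∈ Z
      α-piece : ∀ {e} → α e ≡ true → Star (Linked Eₛ w) (proj₁ d₁) e
      ∂α      : ∀ u → ∂ α u ≡ false
      α-at    : ∀ d → vt d ≡ w → α (proj₁ d) ≡ does (d ≟ᵈ d₁) xor does (d ≟ᵈ d₂)
      M       : List (Dart nE)
      M-piece : ∀ {x} → x ∈ₗ M → Star (Linked Eₛ w) (proj₁ d₁) (proj₁ x)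
      M-sum   : ∀ X ψ → Z ⊆ X → Inv X ψ → ψ (d₁ , false) xor ψ (d₂ , true) ≡ ⨁ M (δᵈ X ψ)

  both-ends : ∀ {e w} b → vt (e , b) ≡ w → vt (e , not b) ≡ w → ∀ b′ → vt (e , b′) ≡ w
  both-ends false p q false = p
  both-ends false p q true = q
  both-ends true p q false = q
  both-ends true p q true = p

  module _ {Z : E} {w : Fin nV} where

    loop-lap : ∀ e b → e ∈ Z → vt (e , b) ≡ w → vt (e , not b) ≡ w → Lap Z w (e , b) (e , not b)
    loop-lap e b e∈ at at′ = record
      { α = indicator e
      ; α⊆Z = λ {x} ix → subst (_∈ Z) (sym (indicator-true {e} {x} ix)) e∈
      ; α-piece = λ {x} ix → subst (Star (Linked Eₛ w) e) (sym (indicator-true {e} {x} ix)) ε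
      ; ∂α = λ u → trans (∂-indicator e b u) (trans (cong₂ (λ x y → does (x ≟ u) xor does (y ≟ u)) at at′) (xor-same (does (w ≟ u))))
      ; α-at = λ d _ → trans (indicator-darts e d) (order d b)
      ; M = proj₁ switch
      ; M-piece = λ {x} x∈ → subst (Star (Linked Eₛ w) e) (sym (proj₁ (proj₂ switch) x∈)) ε
      ; M-sum = proj₂ (proj₂ switch)
      }
      where
        order : ∀ d b → does (d ≟ᵈ (e , false)) xor does (d ≟ᵈ (e , true)) ≡ does (d ≟ᵈ (e , b)) xor does (d ≟ᵈ (e , not b))
        order d false = refl
        order d true = xor-comm (does (d ≟ᵈ (e , false))) _
        -- The strand that starts on the `false` side arrives on side `opposite e false`. For a
        -- twisted loop this is again `false`, and the strand must cross the loop itself once to end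
        -- on the `true` side.
        switch-sides : ∀ s → ∃[ M ] ((∀ {x} → x ∈ₗ M → proj₁ x ≡ e) × (∀ X ψ → Z ⊆ X → Inv X ψ →
          ψ ((e , not b) , s) xor ψ ((e , not b) , true) ≡ ⨁ M (δᵈ X ψ)))
        switch-sides true = [] , (λ ()) , λ X ψ _ _ → xor-same (ψ ((e , not b) , true))
        switch-sides false = [ e , b ] , (λ { (here refl) → refl }) , λ X ψ Z⊆X inv →
          trans (xor-comm (ψ ((e , not b) , false)) _) (trans (across-dart inv (Z⊆X e∈)) (sym (xor-identityʳ _)))
        switch : ∃[ M ] ((∀ {x} → x ∈ₗ M → proj₁ x ≡ e) × (∀ X ψ → Z ⊆ X → Inv X ψ →
          ψ ((e , b) , false) xor ψ ((e , not b) , true) ≡ ⨁ M (δᵈ X ψ)))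
        switch = let (M , M-e , M-sum) = switch-sides (opposite e false) in
          M , M-e , λ X ψ Z⊆X inv → trans (cong (_xor ψ ((e , not b) , true)) (along-edge inv (Z⊆X e∈) b false)) (M-sum X ψ Z⊆X inv)

    module _ (e₁ : Fin nE) where
      -- At such a vertex every dart belongs to the piece of `e₁`, so a curve turning there crosses
      -- only edges of that piece.
      Visited : Fin nV → Set
      Visited u = u ≢ w × ∃[ e ] (At e u × Star (Linked Eₛ w) e₁ e)

      visited-edge : ∀ {e u} → Visited u → At e u → Star (Linked Eₛ w) e₁ e
      visited-edge (u≢w , e′ , at′ , piece) at = piece ◅◅ ((∈⊤ , ∈⊤ , _ , u≢w , at′ , at) ◅ ε)

      within-edge : ∀ {e u v} → e ∈ Z → Star (Linked Eₛ w) e₁ e → At e u → u ≢ w → At e v → v ≢ w →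
        Star (Within Visited Z) u v
      within-edge {e} {u} {v} e∈ piece (b , at) u≢w at′ v≢w with u ≟ v
      ... | yes refl = ε
      ... | no u≢v = (e , b , e∈ , at , v-at , (u≢w , e , (b , at) , piece) , (v≢w , e , at′ , piece)) ◅ ε
        where
          v-at : vt (e , not b) ≡ v
          v-at = At-≢⇒not (λ p → u≢v (trans (sym at) p)) at′

      linked-walk : ∀ {e e′ u v} → Star (Linked Z w) e e′ → e ∈ Z → Star (Linked Eₛ w) e₁ e → At e u → u ≢ w → At e′ v → v ≢ w →
        Star (Within Visited Z) u v
      linked-walk ε e∈ piece at u≢w at′ v≢w = within-edge e∈ piece at u≢w at′ v≢w
      linked-walk ((_ , e″∈ , x , x≢w , ate , ate″) ◅ links) e∈ piece at u≢w at′ v≢w =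
        within-edge e∈ piece at u≢w ate x≢w ◅◅
        linked-walk links e″∈ (piece ◅◅ ((∈⊤ , ∈⊤ , x , x≢w , ate , ate″) ◅ ε)) ate″ x≢w at′ v≢w

    -- The closed curve consists of `e₁`, a path between the far ends that avoids `w`, and `e₂`. The
    -- three boundaries cancel, and only the two given darts of the chain lie at `w`.
    path-lap : ∀ e₁ b₁ e₂ b₂ → e₁ ∈ Z → e₂ ∈ Z → vt (e₁ , b₁) ≡ w → vt (e₂ , b₂) ≡ w →
      vt (e₁ , not b₁) ≢ w → vt (e₂ , not b₂) ≢ w → Star (Linked Z w) e₁ e₂ → Lap Z w (e₁ , b₁) (e₂ , b₂)
    path-lap e₁ b₁ e₂ b₂ e₁∈ e₂∈ at₁ at₂ u₁≢w u₂≢w links = build (path-chain path)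
      (curve-trans {V} {Z} {(e₁ , b₁) , false} {(e₁ , not b₁) , opposite e₁ false} {(e₂ , b₂) , true} (curve-edge {V} e₁∈ b₁ false)
        (curve-trans {V} {Z} {(e₁ , not b₁) , opposite e₁ false} {(e₂ , not b₂) , opposite e₂ true} {(e₂ , b₂) , true}
          (walk path (u₁≢w , e₁ , (not b₁ , refl) , ε) (e₁ , not b₁) (e₂ , not b₂) (opposite e₁ false) (opposite e₂ true) refl refl e₁∈ e₂∈)
          (curve-sym {V} {Z} {(e₂ , b₂) , true} {(e₂ , not b₂) , opposite e₂ true} (curve-edge {V} e₂∈ b₂ true))))
      where
        V = Visited e₁
        u₁ = vt (e₁ , not b₁)
        u₂ = vt (e₂ , not b₂)
        path : Star (Within V Z) u₁ u₂
        path = linked-walk e₁ links e₁∈ ε (not b₁ , refl) u₁≢w (not b₂ , refl) u₂≢w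
        links′ : Star (Linked Eₛ w) e₁ e₂
        links′ = piece-mono (λ _ → ∈⊤) links
        only-dart : ∀ {e b} → vt (e , b) ≡ w → vt (e , not b) ≢ w → ∀ d → vt d ≡ w → indicator e (proj₁ d) ≡ does (d ≟ᵈ (e , b))
        only-dart {e} {b} at off (x , c) at′ with (x , c) ≟ᵈ (e , b)
        ... | yes refl = dec-true (e ≟ e) refl
        ... | no d≢ = dec-false (x ≟ e) (λ { refl → off (trans (cong (λ c → vt (e , c)) (sym (≢⇒≡not (λ { refl → d≢ refl })))) at′) })
        build : ∃[ β ] ((∀ {e} → β e ≡ true → e ∈ Z × ∀ b → V (vt (e , b))) × (∀ x → ∂ β x ≡ does (u₁ ≟ x) xor does (u₂ ≟ x))) →
          Curve V Z ((e₁ , b₁) , false) ((e₂ , b₂) , true) → Lap Z w (e₁ , b₁) (e₂ , b₂)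
        build (β , β-supp , ∂β) (M , M-visited , M-sum) = record
          { α = α
          ; α⊆Z = λ {e} αe → proj₁ (supp e αe)
          ; α-piece = λ {e} αe → proj₂ (supp e αe)
          ; ∂α = λ u → begin
              ∂ α u                                                                     ≡⟨ ∂-xor (λ x → indicator e₁ x xor indicator e₂ x) β u ⟩
              ∂ (λ x → indicator e₁ x xor indicator e₂ x) u xor ∂ β u                   ≡⟨ cong₂ _xor_ (trans (∂-xor (indicator e₁) (indicator e₂) u) (cong₂ _xor_ (∂-at at₁ u) (∂-at at₂ u))) (∂β u) ⟩
              ((v u xor v₁ u) xor (v u xor v₂ u)) xor (v₁ u xor v₂ u)                   ≡⟨ cancel (v u) (v₁ u) (v₂ u) ⟩
              false                                                                     ∎
          ; α-at = λ d at → trans (cong₂ _xor_ (cong₂ _xor_ (only-dart at₁ u₁≢w d at) (only-dart at₂ u₂≢w d at)) (off-w d at)) (xor-identityʳ _)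
          ; M = M
          ; M-piece = λ {x} x∈ → visited-edge e₁ (M-visited x∈) (proj₂ x , refl)
          ; M-sum = M-sum
          }
          where
            open ≡-Reasoning
            α : Fin nE → Bool
            α x = (indicator e₁ x xor indicator e₂ x) xor β x
            v v₁ v₂ : Fin nV → Bool
            v u = does (w ≟ u)
            v₁ u = does (u₁ ≟ u)
            v₂ u = does (u₂ ≟ u)
            ∂-at : ∀ {e b} → vt (e , b) ≡ w → ∀ u → ∂ (indicator e) u ≡ does (w ≟ u) xor does (vt (e , not b) ≟ u)
            ∂-at {e} {b} at u = trans (∂-indicator e b u) (cong (λ x → does (x ≟ u) xor does (vt (e , not b) ≟ u)) at)
            cancel : ∀ a b c → ((a xor b) xor (a xor c)) xor (b xor c) ≡ false
            cancel a b c = trans (cong (_xor (b xor c)) (trans (xor-interchange a b a c) (cong (_xor (b xor c)) (xor-same a)))) (xor-same (b xor c))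
            supp : ∀ e → α e ≡ true → e ∈ Z × Star (Linked Eₛ w) e₁ e
            supp e αe with xor-true (indicator e₁ e xor indicator e₂ e) αe
            ... | inj₂ βe = proj₁ (β-supp βe) , visited-edge e₁ (proj₂ (β-supp βe) false) (false , refl)
            ... | inj₁ i with xor-true (indicator e₁ e) i
            ... | inj₁ i₁ = subst (λ e → e ∈ Z × Star (Linked Eₛ w) e₁ e) (sym (indicator-true {e₁} {e} i₁)) (e₁∈ , ε)
            ... | inj₂ i₂ = subst (λ e → e ∈ Z × Star (Linked Eₛ w) e₁ e) (sym (indicator-true {e₂} {e} i₂)) (e₂∈ , links′)
            off-w : ∀ d → vt d ≡ w → β (proj₁ d) ≡ false
            off-w (e , b) at with β e in eq
            ... | false = refl
            ... | true = ⊥-elim (proj₁ (proj₂ (β-supp eq) b) at)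

    -- A loop at `w` is a piece by itself. Hence the two darts are the ends of one loop, or both
    -- their edges lead away from `w`.
    lap : ∀ {d₁ d₂} → d₁ ≢ d₂ → vt d₁ ≡ w → vt d₂ ≡ w → proj₁ d₁ ∈ Z → proj₁ d₂ ∈ Z →
      Star (Linked Z w) (proj₁ d₁) (proj₁ d₂) → Lap Z w d₁ d₂
    lap {e₁ , b₁} {e₂ , b₂} d₁≢d₂ at₁ at₂ e₁∈ e₂∈ links
      with vt (e₁ , not b₁) ≟ w | vt (e₂ , not b₂) ≟ w
    ... | no off₁ | no off₂ = path-lap e₁ b₁ e₂ b₂ e₁∈ e₂∈ at₁ at₂ off₁ off₂ links
    ... | yes at₁′ | _ = same-edge (loop-isolated (both-ends b₁ at₁ at₁′) links)
      where
        same-edge : e₁ ≡ e₂ → Lap Z w (e₁ , b₁) (e₂ , b₂)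
        same-edge refl with ≢⇒≡not {b₂} {b₁} (λ { refl → d₁≢d₂ refl })
        ... | refl = loop-lap e₁ b₁ e₁∈ at₁ at₂
    ... | no off₁ | yes at₂′ = ⊥-elim (same-edge (loop-isolated (both-ends b₂ at₂ at₂′) (piece-sym links)))
      where
        same-edge : e₂ ≡ e₁ → ⊥
        same-edge refl = off₁ (both-ends b₂ at₂ at₂′ (not b₁))

-- Tools for the dimension count.

split-zero : ∀ m {n} {x : Fin (m + n) → Bool} → (∀ i → x (i ↑ˡ n) ≡ false) → (∀ i → x (m ↑ʳ i) ≡ false) → ∀ j → x j ≡ false
split-zero m {n} {x} l r j = subst (λ j → x j ≡ false) (FP.join-splitAt m n j) (zero-at (splitAt m j))
  where
    zero-at : ∀ s → x (Data.Fin.join m n s) ≡ false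
    zero-at (inj₁ i) = l i
    zero-at (inj₂ i) = r i

Linear-xor : ∀ {m} {F H : (Fin m → Bool) → Bool} → Linear F → Linear H → Linear (λ x → F x xor H x)
Linear-xor {F = F} {H} linF linH x y = trans (cong₂ _xor_ (linF x y) (linH x y)) (xor-interchange (F x) (F y) (H x) (H y))

Linear-∧ : ∀ {m} b {F : (Fin m → Bool) → Bool} → Linear F → Linear (λ x → b ∧ F x)
Linear-∧ false linF x y = refl
Linear-∧ true linF x y = linF x y

Linear-∧ʳ : ∀ {m} b {F : (Fin m → Bool) → Bool} → Linear F → Linear (λ x → F x ∧ b)
Linear-∧ʳ b {F} linF x y = trans (cong (_∧ b) (linF x y)) (∧-distribʳ-xor b (F x) (F y))

Linear-⨁ : ∀ {m} {A : Set} (is : List A) (F : A → (Fin m → Bool) → Bool) → (∀ i → Linear (F i)) → Linear (λ x → ⨁ is (λ i → F i x))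
Linear-⨁ is F linF x y = trans (⨁-cong is (λ i _ → linF i x y)) (⨁-xor is (λ i → F i x) (λ i → F i y))

⨁-select : ∀ {n} (w : Fin n → Bool) j → ⨁ (allFin n) (λ i → w i ∧ does (i ≟ j)) ≡ w j
⨁-select {n} w j = trans (⨁-cong (allFin n) (λ i _ → only i)) (trans (⨁-∧ (allFin n) (w j) (λ i → does (i ≟ j)))
    (trans (cong (w j ∧_) (⨁-∈ _≟_ (U.allFin⁺ n) (∈-allFin j))) (∧-identityʳ (w j))))
  where
    only : ∀ i → w i ∧ does (i ≟ j) ≡ w j ∧ does (i ≟ j)
    only i with i ≟ j
    ... | yes refl = refl
    ... | no _ = trans (∧-zeroʳ (w i)) (sym (∧-zeroʳ (w j)))

lookup-injective : ∀ {A : Set} {xs : List A} → Unique xs → ∀ i j → L.lookup xs i ≡ L.lookup xs j → i ≡ j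
lookup-injective (_ ∷ u) zero zero eq = refl
lookup-injective (x∉ ∷ u) zero (suc j) eq = ⊥-elim (All.lookup x∉ (∈-lookup j) eq)
lookup-injective (x∉ ∷ u) (suc i) zero eq = ⊥-elim (All.lookup x∉ (∈-lookup i) (sym eq))
lookup-injective (_ ∷ u) (suc i) (suc j) eq = cong suc (lookup-injective u i j eq)

unique-disjoint : ∀ {A : Set} (xs : List A) {ys z} → Unique (xs ++ ys) → z ∈ₗ xs → z ∈ₗ ys → ⊥
unique-disjoint (x ∷ xs) (x∉ ∷ u) (here refl) z∈ = All.lookup x∉ (∈-++⁺ʳ xs z∈) refl
unique-disjoint (x ∷ xs) (_ ∷ u) (there z∈) z∈′ = unique-disjoint xs u z∈ z∈′

unique-suffix : ∀ {A : Set} (xs : List A) {ys} → Unique (xs ++ ys) → Unique ys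
unique-suffix [] u = u
unique-suffix (x ∷ xs) (_ ∷ u) = unique-suffix xs u

unique-prefix : ∀ {A : Set} (xs : List A) {ys} → Unique (xs ++ ys) → Unique xs
unique-prefix [] u = []
unique-prefix (x ∷ xs) (x∉ ∷ u) = AllP.++⁻ˡ xs x∉ ∷ unique-prefix xs u

⊑-∷⁻ : ∀ {A : Set} {x : A} {ws xs} → x ∷ ws ⊑ xs → ∃₂ λ as bs → xs ≡ as ++ x ∷ bs × ws ⊑ bs
⊑-∷⁻ (y ∷ʳ s) with ⊑-∷⁻ s
... | as , bs , refl , s′ = y ∷ as , bs , refl , s′
⊑-∷⁻ (refl ∷ s) = [] , _ , refl , s

-- Euler's formula and intersection numbers modulo 2.

module Genus (G : RibbonGraph) where
  open RibbonGraph G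
  open RG G
  open Graph G

  CycSucc-∈ : ∀ {A : Set} {xs : List A} {x y} → CycSucc xs x y → x ∈ₗ xs × y ∈ₗ xs
  CycSucc-∈ (inj₁ (ys , zs , refl)) = ∈-++⁺ʳ ys (here refl) , ∈-++⁺ʳ ys (there (here refl))
  CycSucc-∈ (inj₂ (inj₁ (ys , refl))) = there (∈-++⁺ʳ ys (here refl)) , here refl
  CycSucc-∈ (inj₂ (inj₂ (refl , refl))) = here refl , here refl

  BdAdj-PtIn : ∀ {X p q} → BdAdj X p q → PtIn X p × PtIn X q
  BdAdj-PtIn {X} (vtx v d d′ succ) = ∈rotIn {u = v} (proj₁ (CycSucc-∈ succ)) , ∈rotIn {u = v} (proj₂ (CycSucc-∈ succ))
  BdAdj-PtIn (untw e s e∈ _) = e∈ , e∈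
  BdAdj-PtIn (tw e s e∈ _) = e∈ , e∈

  module _ {X : E} (conn : Connected X) {e₀ : Fin nE} (e₀∈ : e₀ ∈ X) where

    -- `X` is connected, so a curve beside its edges joins any two points, and the colour changes
    -- along it by values of `δ` only.
    constant : ∀ {ψ} → Inv X ψ → (∀ e → δ X ψ e ≡ false) → ∀ p q → PtIn X p → PtIn X q → ψ p ≡ ψ q
    constant {ψ} inv δ≡0 (d@(e , b) , s) (d′@(e′ , b′) , s′) p∈ q∈ =
      trivial-curve (walk (Star.map Step⇒Within (conn (vt d) (vt d′) (At⇒Inc p∈ (b , refl)) (At⇒Inc q∈ (b′ , refl))))
        tt d d′ s s′ refl refl p∈ q∈)
      where
        trivial-curve : Curve (λ _ → ⊤) X (d , s) (d′ , s′) → ψ (d , s) ≡ ψ (d′ , s′)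
        trivial-curve (M , _ , M-sum) = xor-false⇒≡ _ _ (trans (M-sum X ψ (λ x∈ → x∈) inv) (⨁-zero M (λ x _ → δ≡0 (proj₁ x))))

    -- Colourings of the faces (modulo constants), k further cycles that are independent of their
    -- coboundaries, and paths from a root to the other vertices are independent in the space of chains.
    independent⇒≤ : ∀ {f} → Faces X f → ∀ k (α : Fin k → Fin nE → Bool) →
      (∀ i {e} → α i e ≡ true → e ∈ X) → (∀ i u → ∂ (α i) u ≡ false) →
      (∀ ψ → Inv X ψ → ∀ (t : Fin k → Bool) → (∀ e → δ X ψ e xor ⨁ (allFin k) (λ i → t i ∧ α i e) ≡ false) → ∀ i → t i ≡ false) →
      f + (k + nVerts X) ≤ ∣ X ∣ + 2
    independent⇒≤ {f} (c , c-faces , c-onto) k α α⊆X ∂α indep =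
      subst (f + (k + v) ≤_) lengthFs (trivial-kernel⇒≤ Fs linFs kernel)
      where
        vs : List (Fin nV)
        vs = filter (λ v → any? (λ d → proj₁ d ∈? X) (rot v)) (allFin nV)
        v = length vs
        Space = Fin (f + (k + v)) → Bool
        φ : Space → Fin f → Bool
        φ x i = x (i ↑ˡ (k + v))
        t : Space → Fin k → Bool
        t x i = x (f ↑ʳ (i ↑ˡ v))
        w : Space → Fin v → Bool
        w x j = x (f ↑ʳ (k ↑ʳ j))
        r = vt (e₀ , false)
        r-inc : Inc X r
        r-inc = At⇒Inc e₀∈ (false , refl)
        r∈ : r ∈ₗ vs
        r∈ = ∈-filter⁺ (λ v → any? (λ d → proj₁ d ∈? X) (rot v)) (∈-allFin r) r-inc
        vs-unique : Unique vs
        vs-unique = U.filter⁺ _ (U.allFin⁺ nV)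
        tree : ∀ j → ∃[ τ ] ((∀ {e} → τ e ≡ true → e ∈ X × (Bool → ⊤)) ×
          (∀ x → ∂ τ x ≡ does (r ≟ x) xor does (L.lookup vs j ≟ x)))
        tree j = path-chain (Star.map Step⇒Within (conn r (L.lookup vs j) r-inc
          (proj₂ (∈-filter⁻ (λ v → any? (λ d → proj₁ d ∈? X) (rot v)) {xs = allFin nV} (∈-lookup {xs = vs} j)))))
        τ : Fin v → Fin nE → Bool
        τ j = proj₁ (tree j)
        cycles : Space → Fin nE → Bool
        cycles x e = ⨁ (allFin k) (λ i → t x i ∧ α i e)
        paths : Space → Fin nE → Bool
        paths x e = ⨁ (allFin v) (λ j → w x j ∧ τ j e)
        chain : Space → Fin nE → Bool
        chain x e = (δ X (φ x ∘ c) e xor cycles x e) xor paths x e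
        p₀ : Pt
        p₀ = (e₀ , false) , false
        -- The first two functionals remove the trivial solutions, namely constant colourings and
        -- the path from the root to itself. They account for the `2` added to the number of edges.
        Fs : List (Space → Bool)
        Fs = (λ x → φ x (c p₀)) ∷ (λ x → w x (Any.index r∈)) ∷ map (λ e x → chain x e) (elements X)
        lengthFs : length Fs ≡ ∣ X ∣ + 2
        lengthFs = trans (cong (2 +_) (trans (length-map (λ e x → chain x e) (elements X)) (length-elements X))) (ℕ.+-comm 2 ∣ X ∣)
        lin-chain : ∀ e → Linear (λ x → chain x e)
        lin-chain e = Linear-xor {F = λ x → δ X (φ x ∘ c) e xor cycles x e} {paths′}
            (Linear-xor {F = λ x → δ X (φ x ∘ c) e} {λ x → cycles x e}
              (Linear-∧ (lookup X e) {λ x → φ x (c ((e , false) , false)) xor φ x (c ((e , false) , true))}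
                (Linear-xor {F = λ x → φ x (c ((e , false) , false))} {λ x → φ x (c ((e , false) , true))} (λ _ _ → refl) (λ _ _ → refl)))
              (Linear-⨁ (allFin k) (λ i x → t x i ∧ α i e) (λ i → Linear-∧ʳ (α i e) {λ x → t x i} (λ _ _ → refl))))
            (Linear-⨁ (allFin v) (λ j x → w x j ∧ τ j e) (λ j → Linear-∧ʳ (τ j e) {λ x → w x j} (λ _ _ → refl)))
          where
            paths′ : Space → Bool
            paths′ x = paths x e
        linFs : All Linear Fs
        linFs = (λ _ _ → refl) ∷ (λ _ _ → refl) ∷ AllP.map⁺ (All.tabulate (λ {e} _ → lin-chain e))
        inv : ∀ x → Inv X (φ x ∘ c)
        inv x p q adj = cong (φ x) (proj₂ (c-faces p q (proj₁ (BdAdj-PtIn adj)) (proj₂ (BdAdj-PtIn adj))) (EqC.return adj))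
        off-X : ∀ {n} (s : Fin n → Bool) (β : Fin n → Fin nE → Bool) → (∀ i {e} → β i e ≡ true → e ∈ X) →
          ∀ {e} → e ∉ X → ⨁ (allFin n) (λ i → s i ∧ β i e) ≡ false
        off-X s β β⊆X {e} e∉ = ⨁-zero (allFin _) λ i _ → trans (cong (s i ∧_) (β-off i)) (∧-zeroʳ (s i))
          where
            β-off : ∀ i → β i e ≡ false
            β-off i with β i e in eq
            ... | false = refl
            ... | true = ⊥-elim (e∉ (β⊆X i eq))
        ∂-sum : ∀ {n} (s : Fin n → Bool) (β : Fin n → Fin nE → Bool) u →
          ∂ (λ e → ⨁ (allFin n) (λ i → s i ∧ β i e)) u ≡ ⨁ (allFin n) (λ i → s i ∧ ∂ (β i) u)
        ∂-sum {n} s β u = trans (⨁-swap (rot u) (allFin n) (λ d i → s i ∧ β i (proj₁ d)))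
          (⨁-cong (allFin n) (λ i _ → ⨁-∧ (rot u) (s i) (β i ∘ proj₁)))
        kernel : ∀ x → All (λ F → F x ≡ false) Fs → ∀ j → x j ≡ false
        kernel x (φ₀ ∷ w₀ ∷ chain₀) = split-zero f φ≡0 (split-zero k t≡0 w≡0)
          where
            open ≡-Reasoning
            chain≡0 : ∀ e → chain x e ≡ false
            chain≡0 e with e ∈? X
            ... | yes e∈ = All.lookup (AllP.map⁻ chain₀) (∈-elements e∈)
            ... | no e∉ = cong₂ _xor_ (cong₂ _xor_ (δ-∉ {ψ = φ x ∘ c} e∉) (off-X (t x) α α⊆X e∉)) (off-X (w x) τ (λ j τe → proj₁ (proj₁ (proj₂ (tree j)) τe)) e∉)
            ∂-paths : ∀ u → ∂ (paths x) u ≡ false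
            ∂-paths u = begin
              ∂ (paths x) u
                ≡⟨ sym (cong₂ (λ a b → (a xor b) xor ∂ (paths x) u) (∂δ≡0 (inv x) u)
                     (trans (∂-sum (t x) α u) (⨁-zero (allFin k) (λ i _ → trans (cong (t x i ∧_) (∂α i u)) (∧-zeroʳ (t x i)))))) ⟩
              (∂ (δ X (φ x ∘ c)) u xor ∂ (cycles x) u) xor ∂ (paths x) u
                ≡⟨ sym (trans (∂-xor (λ e → δ X (φ x ∘ c) e xor cycles x e) (paths x) u) (cong (_xor ∂ (paths x) u) (∂-xor (δ X (φ x ∘ c)) (cycles x) u))) ⟩
              ∂ (chain x) u
                ≡⟨ ⨁-zero (rot u) (λ d _ → chain≡0 (proj₁ d)) ⟩
              false ∎
            -- Coboundaries and cycles have no boundary, so the boundary of the chain at a vertex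
            -- other than the root is the coefficient of its path. The paths vanish first, then the
            -- cycles by `indep`, and the colouring last.
            w≡0 : ∀ j → w x j ≡ false
            w≡0 j with r ≟ L.lookup vs j
            ... | yes eq = trans (cong (w x) (lookup-injective vs-unique j (Any.index r∈) (trans (sym eq) (lookup-index r∈)))) w₀
            ... | no r≢ = begin
                w x j
                  ≡⟨ sym (⨁-select (w x) j) ⟩
                ⨁ (allFin v) (λ i → w x i ∧ does (i ≟ j))
                  ≡⟨ ⨁-cong (allFin v) (λ i _ → cong (w x i ∧_) (sym (∂τ i))) ⟩
                ⨁ (allFin v) (λ i → w x i ∧ ∂ (τ i) (L.lookup vs j))
                  ≡⟨ sym (∂-sum (w x) τ (L.lookup vs j)) ⟩
                ∂ (paths x) (L.lookup vs j)
                  ≡⟨ ∂-paths (L.lookup vs j) ⟩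
                false ∎
              where
                same-index : ∀ i → does (L.lookup vs i ≟ L.lookup vs j) ≡ does (i ≟ j)
                same-index i with i ≟ j
                ... | yes refl = dec-true (L.lookup vs i ≟ L.lookup vs i) refl
                ... | no i≢j = dec-false (L.lookup vs i ≟ L.lookup vs j) (i≢j ∘ lookup-injective vs-unique i j)
                ∂τ : ∀ i → ∂ (τ i) (L.lookup vs j) ≡ does (i ≟ j)
                ∂τ i = trans (proj₂ (proj₂ (tree i)) (L.lookup vs j))
                  (cong₂ _xor_ (dec-false (r ≟ L.lookup vs j) r≢) (same-index i))
            no-paths : ∀ e → paths x e ≡ false
            no-paths e = ⨁-zero (allFin v) (λ j _ → cong (_∧ τ j e) (w≡0 j))
            t≡0 : ∀ i → t x i ≡ false
            t≡0 = indep (φ x ∘ c) (inv x) (t x) (λ e → trans (sym (trans (cong (λ b → (δ X (φ x ∘ c) e xor cycles x e) xor b) (no-paths e)) (xor-identityʳ (δ X (φ x ∘ c) e xor cycles x e)))) (chain≡0 e))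
            no-cycles : ∀ e → cycles x e ≡ false
            no-cycles e = ⨁-zero (allFin k) (λ i _ → cong (_∧ α i e) (t≡0 i))
            δ≡0 : ∀ e → δ X (φ x ∘ c) e ≡ false
            δ≡0 e = trans (sym (trans (cong₂ (λ a b → (δ X (φ x ∘ c) e xor a) xor b) (no-cycles e) (no-paths e))
              (trans (xor-identityʳ _) (xor-identityʳ _)))) (chain≡0 e)
            φ≡0 : ∀ i → φ x i ≡ false
            φ≡0 i with c-onto i
            ... | p , p∈ , refl = trans (constant {φ x ∘ c} (inv x) δ≡0 p p₀ p∈ e₀∈) φ₀

  module _ {X : E} where

    -- Orthogonality to all coboundaries, as holds for the darts crossed by a closed curve. For such
    -- `M` the pairing with a cycle is an intersection number.
    Vanishing : List (Dart nE) → Set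
    Vanishing M = ∀ ψ → Inv X ψ → ⨁ M (δᵈ X ψ) ≡ false

    evaluate : ∀ {k M} → Vanishing M → ∀ (α : Fin k → Fin nE → Bool) ψ → Inv X ψ → ∀ (t : Fin k → Bool) →
      (∀ e → δ X ψ e xor ⨁ (allFin k) (λ i → t i ∧ α i e) ≡ false) →
      ⨁ (allFin k) (λ i → t i ∧ ⨁ M (α i ∘ proj₁)) ≡ false
    evaluate {k} {M} van α ψ inv t zero-sum = begin
        ⨁ (allFin k) (λ i → t i ∧ ⨁ M (α i ∘ proj₁))                    ≡⟨ ⨁-cong (allFin k) (λ i _ → sym (⨁-∧ M (t i) (α i ∘ proj₁))) ⟩
        ⨁ (allFin k) (λ i → ⨁ M (λ d → t i ∧ α i (proj₁ d)))           ≡⟨ ⨁-swap (allFin k) M (λ i d → t i ∧ α i (proj₁ d)) ⟩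
        ⨁ M combination                                                ≡⟨ cong (_xor ⨁ M combination) (sym (van ψ inv)) ⟩
        ⨁ M (δᵈ X ψ) xor ⨁ M combination                               ≡⟨ sym (⨁-xor M (δᵈ X ψ) combination) ⟩
        ⨁ M (λ d → δᵈ X ψ d xor combination d)                         ≡⟨ ⨁-zero M (λ d _ → zero-sum (proj₁ d)) ⟩
        false                                                          ∎
      where
        open ≡-Reasoning
        combination : Dart nE → Bool
        combination d = ⨁ (allFin k) (λ i → t i ∧ α i (proj₁ d))

    -- In a plane subgraph the coboundaries of face colourings exhaust the cycles.
    plane-vanishing : Plane X → Nonempty X → ∀ {M} → Vanishing M →
      ∀ α → (∀ {e} → α e ≡ true → e ∈ X) → (∀ u → ∂ α u ≡ false) → ⨁ M (α ∘ proj₁) ≡ false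
    plane-vanishing (conn , f , faces , euler) (e₀ , e₀∈) {M} van α α⊆X ∂α with ⨁ M (α ∘ proj₁) in eq
    ... | false = refl
    -- A nonzero pairing makes `α` independent of the coboundaries; `k = 1` then exceeds the value
    -- of `v + f` given by Euler genus 0 by one.
    ... | true = ⊥-elim (ℕ.<-irrefl refl (ℕ.≤-trans
        (ℕ.≤-reflexive (trans (cong suc (trans (sym euler) (trans (ℕ.+-identityʳ _) (ℕ.+-comm (nVerts X) f)))) (sym (ℕ.+-suc f (nVerts X)))))
        (independent⇒≤ conn e₀∈ faces 1 (λ _ → α) (λ _ → α⊆X) (λ _ → ∂α) indep)))
      where
        indep : ∀ ψ → Inv X ψ → ∀ (t : Fin 1 → Bool) → (∀ e → δ X ψ e xor ⨁ (allFin 1) (λ i → t i ∧ α e) ≡ false) → ∀ i → t i ≡ false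
        indep ψ inv t zero-sum zero = trans (sym (trans (xor-identityʳ _) (trans (cong (t zero ∧_) eq) (∧-identityʳ _))))
          (evaluate {1} {M} van (λ _ → α) ψ inv t zero-sum)

    -- The pairings of `M` and `N` with `α` and `β` form a matrix with rows (0, 1) and (1, ∗). It is
    -- invertible, so `α` and `β` are independent modulo coboundaries, whereas Euler genus 1 leaves
    -- room for one such cycle.
    RP2-vanishing : RP2 X → Nonempty X → ∀ {M N} → Vanishing M → Vanishing N →
      ∀ α β → (∀ {e} → α e ≡ true → e ∈ X) → (∀ {e} → β e ≡ true → e ∈ X) →
      (∀ u → ∂ α u ≡ false) → (∀ u → ∂ β u ≡ false) →
      ⨁ M (α ∘ proj₁) ≡ false → ⨁ M (β ∘ proj₁) ≡ true → ⨁ N (α ∘ proj₁) ≡ true → ⊥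
    RP2-vanishing (conn , f , faces , euler) (e₀ , e₀∈) {M} {N} vanM vanN α β α⊆X β⊆X ∂α ∂β Mα Mβ Nα =
        ℕ.<-irrefl refl (ℕ.≤-trans (ℕ.≤-reflexive count)
          (independent⇒≤ conn e₀∈ faces 2 γ γ⊆X ∂γ indep))
      where
        open ≡-Reasoning
        count : suc (∣ X ∣ + 2) ≡ f + (2 + nVerts X)
        count = begin
          suc (∣ X ∣ + 2)              ≡⟨ cong suc (sym euler) ⟩
          suc (nVerts X + f + 1)       ≡⟨ cong suc (ℕ.+-comm (nVerts X + f) 1) ⟩
          2 + (nVerts X + f)           ≡⟨ cong (2 +_) (ℕ.+-comm (nVerts X) f) ⟩
          2 + (f + nVerts X)           ≡⟨ cong suc (sym (ℕ.+-suc f (nVerts X))) ⟩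
          1 + (f + (1 + nVerts X))     ≡⟨ sym (ℕ.+-suc f (1 + nVerts X)) ⟩
          f + (2 + nVerts X)           ∎
        γ : Fin 2 → Fin nE → Bool
        γ zero = α
        γ (suc zero) = β
        γ⊆X : ∀ i {e} → γ i e ≡ true → e ∈ X
        γ⊆X zero = α⊆X
        γ⊆X (suc zero) = β⊆X
        ∂γ : ∀ i u → ∂ (γ i) u ≡ false
        ∂γ zero = ∂α
        ∂γ (suc zero) = ∂β
        solve : ∀ a b {m n p q} → m ≡ false → n ≡ true → p ≡ true →
          (a ∧ m) xor ((b ∧ n) xor false) ≡ false → (a ∧ p) xor ((b ∧ q) xor false) ≡ false → a ≡ false × b ≡ false
        solve false false refl refl refl _ _ = refl , refl
        solve true false refl refl refl _ ()
        solve true true refl refl refl () _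
        indep : ∀ ψ → Inv X ψ → ∀ (t : Fin 2 → Bool) → (∀ e → δ X ψ e xor ⨁ (allFin 2) (λ i → t i ∧ γ i e) ≡ false) → ∀ i → t i ≡ false
        indep ψ inv t zero-sum = both (solve (t zero) (t (suc zero)) Mα Mβ Nα
            (evaluate {2} {M} vanM γ ψ inv t zero-sum) (evaluate {2} {N} vanN γ ψ inv t zero-sum))
          where
            both : t zero ≡ false × t (suc zero) ≡ false → ∀ i → t i ≡ false
            both (p , q) zero = p
            both (p , q) (suc zero) = q

  -- Interleaved darts and crossing curves.

  Straddles : List (Dart nE) → (d₁ d₂ d₁′ d₂′ : Dart nE) → Set
  Straddles xs d₁ d₂ d₁′ d₂′ = ∃₂ λ as bs → ∃[ ds ] (xs ≡ as ++ d₁ ∷ bs ++ d₂ ∷ ds ×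
    ((d₁′ ∈ₗ bs × d₂′ ∉ₗ bs) ⊎ (d₁′ ∉ₗ bs × d₂′ ∈ₗ bs)))

  crossing⇒straddles : ∀ {xs p q p′ q′} → Unique xs → p ∷ q ∷ p′ ∷ q′ ∷ [] ⊑ xs →
    Straddles xs p p′ q q′ × Straddles xs q q′ p p′
  crossing⇒straddles {xs} {p} {q} {p′} {q′} u s with ⊑-∷⁻ s
  ... | a , _ , refl , s₁ with ⊑-∷⁻ s₁
  ... | b , _ , refl , s₂ with ⊑-∷⁻ s₂
  ... | c , _ , refl , s₃ with ⊑-∷⁻ s₃
  ... | d , e , refl , _ =
      (a , b ++ q ∷ c , d ++ q′ ∷ e , cong (λ zs → a ++ p ∷ zs) (sym (++-assoc b (q ∷ c) _)) ,
        inj₁ (∈-++⁺ʳ b (here refl) , λ q′∈ → unique-disjoint (b ++ q ∷ c) {p′ ∷ d ++ q′ ∷ e}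
          (subst Unique (sym (++-assoc b (q ∷ c) _)) (tail (unique-suffix a u))) q′∈ (there (∈-++⁺ʳ d (here refl))))) ,
      (a ++ p ∷ b , c ++ p′ ∷ d , e , trans (cong (λ zs → a ++ p ∷ b ++ q ∷ zs) (sym (++-assoc c (p′ ∷ d) _))) (sym (++-assoc a (p ∷ b) _)) ,
        inj₂ ((λ p∈ → head∉ (unique-suffix a u) (∈-++⁺ʳ b (there (subst (p ∈ₗ_) (++-assoc c (p′ ∷ d) _) (∈-++⁺ˡ p∈))))) , ∈-++⁺ʳ c (here refl)))
    where
      tail : ∀ {A : Set} {x : A} {xs} → Unique (x ∷ xs) → Unique xs
      tail (_ ∷ u) = u
      head∉ : ∀ {A : Set} {x : A} {xs} → Unique (x ∷ xs) → x ∉ₗ xs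
      head∉ (x∉ ∷ _) x∈ = All.lookup x∉ x∈ refl

  module _ {w : Fin nV} where

    -- The parallel curve leaves beside `d₁`, returns beside `d₂`, and is closed up at `w` by
    -- passing the darts between them.
    crossed : ∀ {Z d₁ d₂ d₁′ d₂′} → Lap Z w d₁ d₂ → Straddles (rot w) d₁ d₂ d₁′ d₂′ → List (Dart nE)
    crossed L (as , bs , _) = Lap.M L ++ bs

    -- The way along the lap and the way around `w` join the same two points, so they measure the
    -- same colour difference twice.
    crossed-vanishing : ∀ {X Z d₁ d₂ d₁′ d₂′} (L : Lap Z w d₁ d₂) (S : Straddles (rot w) d₁ d₂ d₁′ d₂′) →
      Z ⊆ X → proj₁ d₁ ∈ X → proj₁ d₂ ∈ X → Vanishing {X} (crossed L S)
    crossed-vanishing {X} {Z} {d₁} {d₂} L (as , bs , ds , eq , _) Z⊆X d₁∈ d₂∈ ψ inv =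
      trans (⨁-++ (Lap.M L) bs (δᵈ X ψ)) (trans (cong₂ _xor_ (sym (Lap.M-sum L X ψ Z⊆X inv)) (sym (between as d₁ bs d₂ ds eq inv d₁∈ d₂∈)))
        (xor-same (ψ (d₁ , false) xor ψ (d₂ , true))))

    -- Away from `w` the two curves run in different pieces and do not meet. At `w` the second chain
    -- has the darts `d₁′` and `d₂′` only, and exactly one of them is in `bs`.
    crossed-value : ∀ {Z Z′ d₁ d₂ d₁′ d₂′} (L : Lap Z w d₁ d₂) (L′ : Lap Z′ w d₁′ d₂′) (S : Straddles (rot w) d₁ d₂ d₁′ d₂′) →
      ¬ Star (Linked Eₛ w) (proj₁ d₁) (proj₁ d₁′) → ⨁ (crossed L S) (Lap.α L′ ∘ proj₁) ≡ true
    crossed-value {d₁ = d₁} {d₂} {d₁′} {d₂′} L L′ (as , bs , ds , eq , split) apart =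
      trans (⨁-++ (Lap.M L) bs (α ∘ proj₁)) (trans (cong (_xor ⨁ bs (α ∘ proj₁)) (⨁-zero (Lap.M L) off))
        (trans (⨁-cong bs (λ d d∈ → Lap.α-at L′ d (vt-unique (bs⊆ d∈)))) (trans (⨁-xor bs _ _) (odd split))))
      where
        α = Lap.α L′
        bs⊆ : ∀ {d} → d ∈ₗ bs → d ∈ₗ rot w
        bs⊆ d∈ = subst (_ ∈ₗ_) (sym eq) (∈-++⁺ʳ as (there (∈-++⁺ˡ d∈)))
        bs-unique : Unique bs
        bs-unique with unique-suffix as (subst Unique eq (rot-unique w))
        ... | _ ∷ u = unique-prefix bs u
        off : ∀ x → x ∈ₗ Lap.M L → α (proj₁ x) ≡ false
        off x x∈ with α (proj₁ x) in αx
        ... | false = refl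
        ... | true = ⊥-elim (apart (Lap.M-piece L x∈ ◅◅ piece-sym (Lap.α-piece L′ αx)))
        odd : (d₁′ ∈ₗ bs × d₂′ ∉ₗ bs) ⊎ (d₁′ ∉ₗ bs × d₂′ ∈ₗ bs) →
          ⨁ bs (λ d → does (d ≟ᵈ d₁′)) xor ⨁ bs (λ d → does (d ≟ᵈ d₂′)) ≡ true
        odd (inj₁ (in₁ , out₂)) = cong₂ _xor_ (⨁-∈ _≟ᵈ_ bs-unique in₁) (⨁-∉ _≟ᵈ_ bs d₂′ out₂)
        odd (inj₂ (out₁ , in₂)) = cong₂ _xor_ (⨁-∉ _≟ᵈ_ bs d₁′ out₁) (⨁-∈ _≟ᵈ_ bs-unique in₂)

    plane-noncrossing : ∀ {X Z Z′ d₁ d₂ d₁′ d₂′} → Plane X → Z ⊆ X → Z′ ⊆ X → proj₁ d₁ ∈ X → proj₁ d₂ ∈ X →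
      Lap Z w d₁ d₂ → Lap Z′ w d₁′ d₂′ → Straddles (rot w) d₁ d₂ d₁′ d₂′ →
      ¬ Star (Linked Eₛ w) (proj₁ d₁) (proj₁ d₁′) → ⊥
    plane-noncrossing plane Z⊆X Z′⊆X d₁∈ d₂∈ L L′ S apart
      with trans (sym (crossed-value L L′ S apart))
        (plane-vanishing plane (_ , d₁∈) {crossed L S} (crossed-vanishing L S Z⊆X d₁∈ d₂∈) (Lap.α L′) (λ αe → Z′⊆X (Lap.α⊆Z L′ αe)) (Lap.∂α L′))
    ... | ()

    -- Crossing curves in the projective plane both reverse orientation, so that
    -- neither of them lies in a plane subgraph.
    RP2-noncrossing : ∀ {X Y Z Z′ d₁ d₂ d₁′ d₂′} → RP2 X → Plane Y → Z ⊆ X → Z ⊆ Y → Z′ ⊆ X →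
      proj₁ d₁ ∈ Z → proj₁ d₂ ∈ Z → proj₁ d₁′ ∈ X → proj₁ d₂′ ∈ X →
      Lap Z w d₁ d₂ → Lap Z′ w d₁′ d₂′ → Straddles (rot w) d₁ d₂ d₁′ d₂′ → Straddles (rot w) d₁′ d₂′ d₁ d₂ →
      ¬ Star (Linked Eₛ w) (proj₁ d₁) (proj₁ d₁′) → ⊥
    RP2-noncrossing rp2 plane Z⊆X Z⊆Y Z′⊆X d₁∈ d₂∈ d₁′∈ d₂′∈ L L′ S S′ apart =
      RP2-vanishing rp2 (_ , d₁′∈) {crossed L S} {crossed L′ S′}
        (crossed-vanishing L S Z⊆X (Z⊆X d₁∈) (Z⊆X d₂∈)) (crossed-vanishing L′ S′ Z′⊆X d₁′∈ d₂′∈)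
        (Lap.α L) (Lap.α L′) (λ αe → Z⊆X (Lap.α⊆Z L αe)) (λ αe → Z′⊆X (Lap.α⊆Z L′ αe)) (Lap.∂α L) (Lap.∂α L′)
        -- The self-intersection of `L` is computed in `Y`. The same list and chain are used in `X`,
        -- so the value 0 carries over.
        (plane-vanishing plane (_ , Z⊆Y d₁∈) {crossed L S} (crossed-vanishing L S Z⊆Y (Z⊆Y d₁∈) (Z⊆Y d₂∈)) (Lap.α L) (λ αe → Z⊆Y (Lap.α⊆Z L αe)) (Lap.∂α L))
        (crossed-value L L′ S apart) (crossed-value L′ L S′ (apart ∘ piece-sym))

-- Pieces and the components of a biseparation.

module Separation (G : RibbonGraph) where
  open RibbonGraph G
  open RG G
  open Graph G
  open Genus G

  ∩-monoʳ : ∀ {Z P Q : E} → P ⊆ Q → Z ∩ P ⊆ Z ∩ Q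
  ∩-monoʳ {Z} {P} P⊆Q x∈ with x∈p∩q⁻ Z P x∈
  ... | x∈Z , x∈P = x∈p∩q⁺ (x∈Z , P⊆Q x∈P)

  -- Excursions into Q start and end at the common vertex v, so they can be cut out.
  project : ∀ {P Q v Z w x y} → Disjoint P Q → (∀ u → Inc P u → Inc Q u → u ≡ v) →
    Star (Linked (Z ∩ (P ∪ Q)) w) x y → y ∈ P →
    (x ∈ P → Star (Linked (Z ∩ P) w) x y) ×
    (x ∈ Q → v ≢ w × (∀ {z} → z ∈ Z → z ∈ P → At z v → Star (Linked (Z ∩ P) w) z y))
  project disj meet ε y∈P = (λ _ → ε) , λ x∈Q → ⊥-elim (disj _ y∈P x∈Q)
  project {P} {Q} {v} {Z} {w} {x} {y} disj meet (_◅_ {j = x′} (x∈ , x′∈ , u , u≢w , at , at′) links) y∈P =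
      fromP , fromQ
    where
      rest = project {P} {Q} {v} {Z} disj meet links y∈P
      x∈Z : x ∈ Z
      x∈Z = proj₁ (x∈p∩q⁻ Z (P ∪ Q) x∈)
      x′∈Z : x′ ∈ Z
      x′∈Z = proj₁ (x∈p∩q⁻ Z (P ∪ Q) x′∈)
      x′∈PQ : x′ ∈ P ⊎ x′ ∈ Q
      x′∈PQ = x∈p∪q⁻ P Q (proj₂ (x∈p∩q⁻ Z (P ∪ Q) x′∈))
      fromP : x ∈ P → Star (Linked (Z ∩ P) w) x y
      fromP x∈P with x′∈PQ
      ... | inj₁ x′∈P = (x∈p∩q⁺ (x∈Z , x∈P) , x∈p∩q⁺ (x′∈Z , x′∈P) , u , u≢w , at , at′) ◅ proj₁ rest x′∈P
      ... | inj₂ x′∈Q = proj₂ (proj₂ rest x′∈Q) x∈Z x∈P (subst (At x) (meet u (At⇒Inc x∈P at) (At⇒Inc x′∈Q at′)) at)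
      -- The excursion re-enters `P` through `v` by a link, which shows that `v` is not `w`. The
      -- claim covers every `z` of `P` at `v` because the edge from which the excursion departed is
      -- known only later in the induction.
      fromQ : x ∈ Q → v ≢ w × (∀ {z} → z ∈ Z → z ∈ P → At z v → Star (Linked (Z ∩ P) w) z y)
      fromQ x∈Q with x′∈PQ
      ... | inj₂ x′∈Q = proj₂ rest x′∈Q
      ... | inj₁ x′∈P with meet u (At⇒Inc x′∈P at′) (At⇒Inc x∈Q at)
      ... | refl = u≢w , λ z∈Z z∈P atz → (x∈p∩q⁺ (z∈Z , z∈P) , x∈p∩q⁺ (x′∈Z , x′∈P) , u , u≢w , atz , at′) ◅ proj₁ rest x′∈P

  ∪-comm⊆ : ∀ {P Q : E} → P ∪ Q ⊆ Q ∪ P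
  ∪-comm⊆ {P} {Q} x∈ with x∈p∪q⁻ P Q x∈
  ... | inj₁ x∈P = x∈p∪q⁺ (inj₂ x∈P)
  ... | inj₂ x∈Q = x∈p∪q⁺ (inj₁ x∈Q)

  -- Both edges are required to be at `w`: a piece may run through several components, but it
  -- returns to `w` in the component in which it left. The set `Z` is arbitrary so that it can also
  -- be a component of another biseparation.
  Separated : E → E → E → Set
  Separated A Z acc = ∀ {w e e′} → At e w → At e′ w → e ∈ acc → e′ ∈ acc → Star (Linked (Z ∩ acc) w) e e′ →
    ∃[ H ] (CompOf A H × e ∈ H × e′ ∈ H × Star (Linked (Z ∩ H) w) e e′)

  -- If the two edges were in different summands, `w` would be the common vertex `v`; but a chain of
  -- links changes summand at `v` and never passes through `w`.
  separated-sum : ∀ {A Z P Q v} → OneSum P Q v → CompOf A Q → Separated A Z P → Separated A Z (P ∪ Q)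
  separated-sum {A} {Z} {P} {Q} {v} (_ , _ , disj , _ , _ , _ , _ , meet) compQ sepP {w} {e} {e′} at at′ e∈ e′∈ links
    with x∈p∪q⁻ P Q e∈ | x∈p∪q⁻ P Q e′∈
  ... | inj₁ e∈P | inj₁ e′∈P = sepP at at′ e∈P e′∈P (proj₁ (project {P} {Q} {v} {Z} disj meet links e′∈P) e∈P)
  ... | inj₂ e∈Q | inj₂ e′∈Q = Q , compQ , e∈Q , e′∈Q ,
          proj₁ (project {Q} {P} {v} {Z} (λ x x∈Q x∈P → disj x x∈P x∈Q) (λ u p q → meet u q p) (piece-mono (∩-monoʳ {Z} ∪-comm⊆) links) e′∈Q) e∈Q
  ... | inj₂ e∈Q | inj₁ e′∈P = ⊥-elim (proj₁ (proj₂ (project {P} {Q} {v} {Z} disj meet links e′∈P) e∈Q)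
          (sym (meet w (At⇒Inc e′∈P at′) (At⇒Inc e∈Q at))))
  ... | inj₁ e∈P | inj₂ e′∈Q = ⊥-elim (proj₁ (proj₂ (project {P} {Q} {v} {Z} disj meet (piece-sym links) e∈P) e′∈Q)
          (sym (meet w (At⇒Inc e∈P at) (At⇒Inc e′∈Q at′))))

  separated-seq : ∀ {A Z} acc Hs → OneSumSeq acc Hs → All (CompOf A) Hs → Separated A Z acc → Separated A Z (foldl _∪_ acc Hs)
  separated-seq acc [] _ _ sep = sep
  separated-seq {A} {Z} acc (H ∷ Hs) ((v , sum) , sums) (comp ∷ comps) sep =
    separated-seq {A} {Z} (acc ∪ H) Hs sums comps (separated-sum {A} {Z} sum comp sep)

  foldl-union : ∀ acc Hs → foldl _∪_ acc Hs ≡ acc ∪ union Hs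
  foldl-union acc [] = sym (∪-identityʳ acc)
  foldl-union acc (H ∷ Hs) = trans (foldl-union (acc ∪ H) Hs) (∪-assoc acc H (union Hs))

  module _ (connG : ConnectedG) where

    biseparation-separated : ∀ {A Z w e e′} → Biseparation A → At e w → At e′ w → Star (Linked Z w) e e′ →
      ∃[ H ] (CompOf A H × e ∈ H × e′ ∈ H × Star (Linked (Z ∩ H) w) e e′)
    biseparation-separated {Z = Z} {e = e} (inj₁ refl) at at′ links =
      Eₛ , inj₂ ((λ _ → x∉p⇒x∈∁p ∉⊥) , (e , ∈⊤) , (λ u w _ _ → connG u w) , λ _ _ _ _ _ _ _ → ∈⊤) , ∈⊤ , ∈⊤ ,
      piece-mono (λ x∈ → x∈p∩q⁺ (x∈ , ∈⊤)) links
    biseparation-separated {Z = Z} {e = e} (inj₂ (inj₁ refl)) at at′ links =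
      Eₛ , inj₁ ((λ _ → ∈⊤) , (e , ∈⊤) , (λ u w _ _ → connG u w) , λ _ _ _ _ _ _ _ → ∈⊤) , ∈⊤ , ∈⊤ ,
      piece-mono (λ x∈ → x∈p∩q⁺ (x∈ , ∈⊤)) links
    biseparation-separated {A} {Z} {w} {e} {e′} (inj₂ (inj₂ (H , Hs , sums , whole , comp ∷ comps , _ , _))) at at′ links =
      subst (Separated A Z) (trans (foldl-union H Hs) whole)
        (separated-seq {A} {Z} H Hs sums comps (λ at at′ e∈ e′∈ links → H , comp , e∈ , e′∈ , links))
        at at′ ∈⊤ ∈⊤ (piece-mono (λ x∈ → x∈p∩q⁺ (x∈ , ∈⊤)) links)

    same-side : ∀ {A H e e′} → CompOf A H → e ∈ H → e′ ∈ H → lookup A e ≡ lookup A e′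
    same-side (inj₁ (H⊆A , _)) e∈ e′∈ = trans (∈⇒lookup (H⊆A e∈)) (sym (∈⇒lookup (H⊆A e′∈)))
    same-side (inj₂ (H⊆∁A , _)) e∈ e′∈ = trans (∉⇒lookup (x∈∁p⇒x∉p (H⊆∁A e∈))) (sym (∉⇒lookup (x∈∁p⇒x∉p (H⊆∁A e′∈))))

    absorb : ∀ {A H e e′ v} → CompOf A H → e ∈ H → At e v → At e′ v → lookup A e ≡ lookup A e′ → e′ ∈ H
    absorb {A} {e′ = e′} (inj₁ (H⊆A , _ , _ , maximal)) e∈ at at′ same =
      maximal _ _ _ (lookup⇒[]= e′ A (trans (sym same) (∈⇒lookup (H⊆A e∈)))) e∈ (At⇒Any at′) (At⇒Any at)
    absorb {A} {e = e} {e′} (inj₂ (H⊆∁A , _ , _ , maximal)) e∈ at at′ same =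
      maximal _ _ _ (x∉p⇒x∈∁p (λ e′∈A → x∈∁p⇒x∉p (H⊆∁A e∈) (lookup⇒[]= e A (trans same (∈⇒lookup e′∈A))))) e∈ (At⇒Any at′) (At⇒Any at)

    piece-same-side : ∀ {A Z w e e′} → Biseparation A → At e w → At e′ w → Star (Linked Z w) e e′ → lookup A e ≡ lookup A e′
    piece-same-side {A} {Z} {w} {e} {e′} bisep at at′ links = in-component (biseparation-separated bisep at at′ links)
      where
        in-component : ∃[ H ] (CompOf A H × e ∈ H × e′ ∈ H × Star (Linked (Z ∩ H) w) e e′) → lookup A e ≡ lookup A e′
        in-component (H , comp , e∈ , e′∈ , _) = same-side {A} {H} comp e∈ e′∈

    -- Consecutive edges of the chain share a vertex and a side of `A`, so `absorb` keeps it inside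
    -- `H`. In effect `H` and `H′` coincide.
    transfer : ∀ {A H H′ Z w e e′} → CompOf A H → CompOf A H′ → e ∈ H → Star (Linked (Z ∩ H′) w) e e′ →
      e′ ∈ H × Star (Linked (Z ∩ H) w) e e′
    transfer comp comp′ e∈ ε = e∈ , ε
    transfer {A} {H} {H′} {Z} {e = e} comp comp′ e∈ (_◅_ {j = x} (eZ , xZ , u , u≢w , at , atx) links) =
      extend (transfer {A} {H} {H′} {Z} comp comp′ x∈ links)
      where
        x∈ : x ∈ H
        x∈ = absorb {A} comp e∈ at atx (same-side {A} comp′ (proj₂ (x∈p∩q⁻ Z H′ eZ)) (proj₂ (x∈p∩q⁻ Z H′ xZ)))
        extend : ∀ {e′} → e′ ∈ H × Star (Linked (Z ∩ H) _) x e′ → e′ ∈ H × Star (Linked (Z ∩ H) _) e e′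
        extend (e′∈ , links) = e′∈ ,
          (x∈p∩q⁺ (proj₁ (x∈p∩q⁻ Z H′ eZ) , e∈) , x∈p∩q⁺ (proj₁ (x∈p∩q⁻ Z H′ xZ) , x∈) , u , u≢w , at , atx) ◅ links

    straddle-≢ : ∀ {w d₁ d₂ d₁′ d₂′} → Straddles (rot w) d₁ d₂ d₁′ d₂′ → d₁ ≢ d₂
    straddle-≢ {w} (as , bs , ds , eq , _) refl with unique-suffix as (subst Unique eq (rot-unique w))
    ... | d∉ ∷ _ = All.lookup d∉ (∈-++⁺ʳ bs (here refl)) refl

    -- Interleaved pieces in plane and projective components.

    module Crossing {w : Fin nV} {p q p′ q′ : Dart nE} (crossing : p ∷ q ∷ p′ ∷ q′ ∷ [] ⊑ rot w)
      (p∼p′ : Star (Linked Eₛ w) (proj₁ p) (proj₁ p′)) (q∼q′ : Star (Linked Eₛ w) (proj₁ q) (proj₁ q′))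
      (apart : ¬ Star (Linked Eₛ w) (proj₁ p) (proj₁ q)) where

      at-w : ∀ {x} → x ∈ₗ p ∷ q ∷ p′ ∷ q′ ∷ [] → vt x ≡ w
      at-w x∈ = vt-unique (Sub.lookup crossing x∈)
      p-at : vt p ≡ w
      p-at = at-w (here refl)
      q-at : vt q ≡ w
      q-at = at-w (there (here refl))
      p′-at : vt p′ ≡ w
      p′-at = at-w (there (there (here refl)))
      q′-at : vt q′ ≡ w
      q′-at = at-w (there (there (there (here refl))))
      S : Straddles (rot w) p p′ q q′
      S = proj₁ (crossing⇒straddles (rot-unique w) crossing)
      S′ : Straddles (rot w) q q′ p p′
      S′ = proj₂ (crossing⇒straddles (rot-unique w) crossing)

      Within-piece : E → Set
      Within-piece X = (proj₁ p ∈ X × proj₁ p′ ∈ X × Star (Linked (Eₛ ∩ X) w) (proj₁ p) (proj₁ p′)) ×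
                       (proj₁ q ∈ X × proj₁ q′ ∈ X × Star (Linked (Eₛ ∩ X) w) (proj₁ q) (proj₁ q′))

      common-component : ∀ {A} → Biseparation A → lookup A (proj₁ p) ≡ lookup A (proj₁ q) →
        ∃[ X ] (CompOf A X × Within-piece X)
      common-component {A} bisep same = combine (separate p-at p′-at p∼p′) (separate q-at q′-at q∼q′)
        where
          separate : ∀ {d d′ : Dart nE} → vt d ≡ w → vt d′ ≡ w → Star (Linked Eₛ w) (proj₁ d) (proj₁ d′) →
            ∃[ H ] (CompOf A H × proj₁ d ∈ H × proj₁ d′ ∈ H × Star (Linked (Eₛ ∩ H) w) (proj₁ d) (proj₁ d′))
          separate {d} {d′} at at′ = biseparation-separated bisep (proj₂ d , at) (proj₂ d′ , at′)
          combine : ∃[ H ] (CompOf A H × proj₁ p ∈ H × proj₁ p′ ∈ H × Star (Linked (Eₛ ∩ H) w) (proj₁ p) (proj₁ p′)) →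
            ∃[ H ] (CompOf A H × proj₁ q ∈ H × proj₁ q′ ∈ H × Star (Linked (Eₛ ∩ H) w) (proj₁ q) (proj₁ q′)) →
            ∃[ X ] (CompOf A X × Within-piece X)
          combine (X , comp , p∈ , p′∈ , plinks) (X′ , comp′ , q∈′ , q′∈′ , qlinks) =
            X , comp , (p∈ , p′∈ , plinks) , (q∈ , transfer {A} {X} {X′} {Eₛ} comp comp′ q∈ qlinks)
            where
              q∈ : proj₁ q ∈ X
              q∈ = absorb {A} comp p∈ (proj₂ p , p-at) (proj₂ q , q-at) same

      plane-impossible : ∀ {X} → Plane X → Within-piece X → ⊥
      plane-impossible {X} plane ((p∈ , p′∈ , plinks) , (q∈ , q′∈ , qlinks)) =
        plane-noncrossing plane ⊆X ⊆X p∈ p′∈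
          (lap (straddle-≢ S) p-at p′-at (∈Z p∈) (∈Z p′∈) plinks)
          (lap (straddle-≢ S′) q-at q′-at (∈Z q∈) (∈Z q′∈) qlinks) S apart
        where
          ⊆X : Eₛ ∩ X ⊆ X
          ⊆X x∈ = proj₂ (x∈p∩q⁻ Eₛ X x∈)
          ∈Z : ∀ {x} → x ∈ X → x ∈ Eₛ ∩ X
          ∈Z x∈ = x∈p∩q⁺ (∈⊤ , x∈)

      plane-case : ∀ {A} → PlaneBiseparation A → lookup A (proj₁ p) ≡ lookup A (proj₁ q) → ⊥
      plane-case {A} (bisep , planes) same = impossible (common-component {A} bisep same)
        where
          impossible : ∃[ X ] (CompOf A X × Within-piece X) → ⊥
          impossible (X , comp , within) = plane-impossible (planes X comp) within

      -- The common component at `A` cannot be plane, hence is `X₀`. At `B` the two pieces start on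
      -- different sides, so one of their components differs from `Y₀` and is plane; the curve lying
      -- in it contradicts `RP2-noncrossing`.
      RP2-case : ∀ {A B} → RP2Biseparation A → RP2Biseparation B →
        lookup A (proj₁ p) ≡ lookup A (proj₁ q) → lookup B (proj₁ p) ≢ lookup B (proj₁ q) → ⊥
      RP2-case {A} {B} (bisepA , X₀ , compX₀ , rp2 , planesA) (bisepB , Y₀ , _ , _ , planesB) same differ =
          at-A (common-component {A} bisepA same)
        where
          Held : E → Dart nE → Dart nE → Set
          Held X d d′ = ∃[ Y ] (CompOf B Y × proj₁ d ∈ Y × proj₁ d′ ∈ Y × Star (Linked (X ∩ Y) w) (proj₁ d) (proj₁ d′))
          at-B : ∀ {X} → RP2 X → Within-piece X → Held X p p′ → Held X q q′ → ⊥
          at-B {X} rp2X ((p∈ , p′∈ , plinks) , (q∈ , q′∈ , qlinks)) (Y , comp , p∈Y , p′∈Y , pl) (Y′ , comp′ , q∈Y′ , q′∈Y′ , ql) =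
              decide (≡-decᵛ _≟ᵇ_ Y Y₀)
            where
              ⊆ˡ : ∀ {Y} → X ∩ Y ⊆ X
              ⊆ˡ {Y} x∈ = proj₁ (x∈p∩q⁻ X Y x∈)
              ⊆ʳ : ∀ {Y} → X ∩ Y ⊆ Y
              ⊆ʳ {Y} x∈ = proj₂ (x∈p∩q⁻ X Y x∈)
              -- Both curves are drawn again inside the intersections, so that each lies in a
              -- component of either biseparation.
              Lp : Lap (X ∩ Y) w p p′
              Lp = lap (straddle-≢ S) p-at p′-at (x∈p∩q⁺ (p∈ , p∈Y)) (x∈p∩q⁺ (p′∈ , p′∈Y)) pl
              Lq : Lap (X ∩ Y′) w q q′
              Lq = lap (straddle-≢ S′) q-at q′-at (x∈p∩q⁺ (q∈ , q∈Y′)) (x∈p∩q⁺ (q′∈ , q′∈Y′)) ql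
              decide : Dec (Y ≡ Y₀) → ⊥
              decide (no Y≢) = RP2-noncrossing rp2X (planesB Y comp Y≢) ⊆ˡ ⊆ʳ ⊆ˡ
                (x∈p∩q⁺ (p∈ , p∈Y)) (x∈p∩q⁺ (p′∈ , p′∈Y)) q∈ q′∈ Lp Lq S S′ apart
              decide (yes refl) = RP2-noncrossing rp2X (planesB Y′ comp′ Y′≢) ⊆ˡ ⊆ʳ ⊆ˡ
                (x∈p∩q⁺ (q∈ , q∈Y′)) (x∈p∩q⁺ (q′∈ , q′∈Y′)) p∈ p′∈ Lq Lp S′ S (apart ∘ piece-sym)
                where
                  Y′≢ : Y′ ≢ Y
                  Y′≢ refl = differ (same-side {B} comp p∈Y q∈Y′)
          at-A : ∃[ X ] (CompOf A X × Within-piece X) → ⊥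
          at-A (X , comp , within@((p∈ , p′∈ , plinks) , (q∈ , q′∈ , qlinks))) = decide (≡-decᵛ _≟ᵇ_ X X₀)
            where
              in-X : ∀ {e e′} → Star (Linked (Eₛ ∩ X) w) e e′ → Star (Linked X w) e e′
              in-X = piece-mono (λ x∈ → proj₂ (x∈p∩q⁻ Eₛ X x∈))
              decide : Dec (X ≡ X₀) → ⊥
              decide (no X≢) = plane-impossible (planesA X comp X≢) within
              decide (yes refl) = at-B rp2 within
                (biseparation-separated bisepB (proj₂ p , p-at) (proj₂ p′ , p′-at) (in-X plinks))
                (biseparation-separated bisepB (proj₂ q , q-at) (proj₂ q′ , q′-at) (in-X qlinks))

lookup-ext : ∀ {n} {A : Set} {xs ys : Vec A n} → (∀ i → lookup xs i ≡ lookup ys i) → xs ≡ ys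
lookup-ext {xs = []} {[]} eq = refl
lookup-ext {xs = _ ∷ _} {_ ∷ _} eq = cong₂ _∷_ (eq zero) (lookup-ext (eq ∘ suc))

unique-rotate : ∀ {A : Set} (ys : List A) {zs} → Unique (ys ++ zs) → Unique (zs ++ ys)
unique-rotate ys u = U.++⁺ (unique-suffix ys u) (unique-prefix ys u) (λ (z∈ , y∈) → unique-disjoint ys u y∈ z∈)

-- Connectivity and decidability of pieces.

module Decomposition (G : RibbonGraph) where
  open RibbonGraph G
  open RG G
  open Graph G
  open Genus G
  open Separation G

  edges-of : List (Dart nE) → E
  edges-of = foldr (λ d S → ⁅ proj₁ d ⁆ ∪ S) ∅ₛ

  ∈-edges-of⁺ : ∀ {d ds} → d ∈ₗ ds → proj₁ d ∈ edges-of ds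
  ∈-edges-of⁺ (here refl) = x∈p∪q⁺ (inj₁ (x∈⁅x⁆ _))
  ∈-edges-of⁺ (there d∈) = x∈p∪q⁺ (inj₂ (∈-edges-of⁺ d∈))

  ∈-edges-of⁻ : ∀ {e} ds → e ∈ edges-of ds → ∃[ d ] (d ∈ₗ ds × e ≡ proj₁ d)
  ∈-edges-of⁻ [] e∈ = ⊥-elim (∉⊥ e∈)
  ∈-edges-of⁻ (d ∷ ds) e∈ with x∈p∪q⁻ ⁅ proj₁ d ⁆ (edges-of ds) e∈
  ... | inj₁ e∈d = d , here refl , x∈⁅y⁆⇒x≡y (proj₁ d) e∈d
  ... | inj₂ e∈ds with ∈-edges-of⁻ ds e∈ds
  ... | d′ , d′∈ , eq = d′ , there d′∈ , eq

  Step-sym : ∀ {X u w} → Step X u w → Step X w u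
  Step-sym (e , e∈ , inj₁ (p , q)) = e , e∈ , inj₂ (q , p)
  Step-sym (e , e∈ , inj₂ (p , q)) = e , e∈ , inj₁ (q , p)

  -- The walk is cut at its first visit to `w`; until then consecutive edges share a vertex other
  -- than `w`, which is a link.
  reaches-vertex : ∀ {X u w e} → Star (Within (λ _ → ⊤) X) u w → e ∈ X → At e u →
    ∃[ d ] (vt d ≡ w × proj₁ d ∈ X × Star (Linked X w) e (proj₁ d))
  reaches-vertex {u = u} {w} {e} path e∈ (b , at) with u ≟ w
  ... | yes refl = (e , b) , at , e∈ , ε
  reaches-vertex ε e∈ at | no u≢w = ⊥-elim (u≢w refl)
  reaches-vertex {X} {u} {w} {e} ((e₁ , b₁ , e₁∈ , at₁ , at₁′ , _) ◅ path) e∈ (b , at) | no u≢w =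
      extend (reaches-vertex path e₁∈ (not b₁ , at₁′))
    where
      extend : ∃[ d ] (vt d ≡ w × proj₁ d ∈ X × Star (Linked X w) e₁ (proj₁ d)) →
        ∃[ d ] (vt d ≡ w × proj₁ d ∈ X × Star (Linked X w) e (proj₁ d))
      extend (d , d-at , d∈ , links) = d , d-at , d∈ , (e∈ , e₁∈ , u , u≢w , (b , at) , (b₁ , at₁)) ◅ links

  reaches : ∀ {X w e} → Connected X → Inc X w → e ∈ X →
    ∃[ d ] (vt d ≡ w × proj₁ d ∈ X × Star (Linked X w) e (proj₁ d))
  reaches {w = w} {e} conn inc e∈ =
    reaches-vertex (Star.map Step⇒Within (conn (vt (e , false)) w (At⇒Inc e∈ (false , refl)) inc)) e∈ (false , refl)

  connected-through : ∀ {S w} → (∀ {e} → e ∈ S → ∃[ d ] (vt d ≡ w × Star (Linked S w) e (proj₁ d))) → Connected S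
  connected-through {S} {w} reach u u′ inc inc′ = to-w (Inc⇒At inc) ◅◅ Star.reverse Step-sym (to-w (Inc⇒At inc′))
    where
      along : ∀ {e e′ u} → e ∈ S → At e u → Star (Linked S w) e e′ → At e′ w → Star (Step S) u w
      along e∈ at ε at′ = edge-ends e∈ at at′
      along e∈ at ((_ , e₁∈ , v , _ , atv , atv₁) ◅ links) at′ = edge-ends e∈ at atv ◅◅ along e₁∈ atv₁ links at′
      to-w : ∀ {u} → ∃[ e ] (e ∈ S × At e u) → Star (Step S) u w
      to-w (e , e∈ , at) with reach e∈
      ... | d , d-at , links = along e∈ at links (proj₂ d , d-at)

  stay : ∀ {X S w e e′} → (∀ {e e′} → e ∈ S → Linked X w e e′ → e′ ∈ S) → e ∈ S → Star (Linked X w) e e′ →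
    e′ ∈ S × Star (Linked S w) e e′
  stay closed e∈ ε = e∈ , ε
  stay {S = S} closed e∈ (l@(_ , _ , r) ◅ links) with stay {S = S} closed (closed e∈ l) links
  ... | e′∈ , links′ = e′∈ , (e∈ , closed e∈ l , r) ◅ links′

  piece? : ∀ X w e e′ → Dec (Star (Linked X w) e e′)
  piece? X w e e′ = decide (reachable (Linked X w) (Linked? X w) ⁅ e ⁆)
    where
      decide : ∃[ S ] (⁅ e ⁆ ⊆ S × (∀ {x} → x ∈ S → ∃[ s ] (s ∈ ⁅ e ⁆ × Star (Linked X w) s x)) ×
        (∀ {x y} → x ∈ S → Linked X w x y → y ∈ S)) → Dec (Star (Linked X w) e e′)
      decide (S , e⊆S , sound , closed) with e′ ∈? S
      ... | no e′∉ = no (λ links → e′∉ (proj₁ (stay {X} {S} closed (e⊆S (x∈⁅x⁆ e)) links)))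
      ... | yes e′∈ with sound e′∈
      ... | s , s∈ , links with x∈⁅y⁆⇒x≡y e s∈
      ... | refl = yes links

  JoinSeq-snoc : ∀ acc Hs {Q} → JoinSeq acc Hs → ∃[ v ] Join (foldl _∪_ acc Hs) Q v → JoinSeq acc (Hs ++ [ Q ])
  JoinSeq-snoc acc [] _ join = join , tt
  JoinSeq-snoc acc (H ∷ Hs) (j , js) join = j , JoinSeq-snoc (acc ∪ H) Hs js join

  -- Peeling off join-summands of one colour.

  module Coloured (χ : Fin nE → Bool)
    (χ-piece : ∀ {w e e′} → At e w → At e′ w → Star (Linked Eₛ w) e e′ → χ e ≡ χ e′)
    (χ-noncrossing : ∀ {w} {p q p′ q′ : Dart nE} → p ∷ q ∷ p′ ∷ q′ ∷ [] ⊑ rot w →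
      Star (Linked Eₛ w) (proj₁ p) (proj₁ p′) → Star (Linked Eₛ w) (proj₁ q) (proj₁ q′) → χ (proj₁ p) ≡ χ (proj₁ q))
    where

    -- The colour of `Q` is controlled at `w` only. `P-closed` makes `P` a union of pieces at `w`,
    -- so anything linked to `d₀` stays in `P`; a later splitting uses this to keep an earlier first
    -- part whole.
    record Split (X : E) (w : Fin nV) (d₀ : Dart nE) : Set where
      field
        P Q      : E
        join     : Join P Q w
        P∪Q      : P ∪ Q ≡ X
        d₀∈P     : proj₁ d₀ ∈ P
        P-closed : ∀ {e e′} → e ∈ P → Linked X w e e′ → e′ ∈ P
        colour   : Bool
        Q-colour : ∀ {e} → e ∈ Q → At e w → χ e ≡ colour

    module _ {X : E} (conn : Connected X) {w : Fin nV} {d₀ : Dart nE} (d₀-at : vt d₀ ≡ w) (d₀∈ : proj₁ d₀ ∈ X) where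

      private
        _∼_ : Dart nE → Dart nE → Set
        d ∼ d′ = Star (Linked X w) (proj₁ d) (proj₁ d′)

        whole : ∀ {e e′} → Star (Linked X w) e e′ → Star (Linked Eₛ w) e e′
        whole = piece-mono (λ _ → ∈⊤)

      in-rotIn : ∀ {d} → vt d ≡ w → proj₁ d ∈ X → d ∈ₗ rotIn X w
      in-rotIn at d∈ = ∈-filter⁺ (λ d → proj₁ d ∈? X) (∈-vt at) d∈

      rotIn-at : ∀ {d} → d ∈ₗ rotIn X w → vt d ≡ w
      rotIn-at d∈ = vt-unique (proj₁ (∈-filter⁻ (λ d → proj₁ d ∈? X) {xs = rot w} d∈))

      module _ (ys zs : List (Dart nE)) (rotated : rotIn X w ≡ ys ++ d₀ ∷ zs) where

        xs : List (Dart nE)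
        xs = d₀ ∷ zs ++ ys

        xs⇒rotIn : ∀ {d} → d ∈ₗ xs → d ∈ₗ rotIn X w
        xs⇒rotIn d∈ with ∈-++⁻ (d₀ ∷ zs) d∈
        ... | inj₁ d∈z = subst (_ ∈ₗ_) (sym rotated) (∈-++⁺ʳ ys d∈z)
        ... | inj₂ d∈y = subst (_ ∈ₗ_) (sym rotated) (∈-++⁺ˡ d∈y)

        rotIn⇒xs : ∀ {d} → d ∈ₗ rotIn X w → d ∈ₗ xs
        rotIn⇒xs d∈ with ∈-++⁻ ys (subst (_ ∈ₗ_) rotated d∈)
        ... | inj₁ d∈y = ∈-++⁺ʳ (d₀ ∷ zs) d∈y
        ... | inj₂ d∈z = ∈-++⁺ˡ d∈z

        xs-unique : Unique xs
        xs-unique = unique-rotate ys (subst Unique rotated (U.filter⁺ (λ d → proj₁ d ∈? X) (rot-unique w)))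

        resp : ∀ {x y} → x ∈ₗ xs → y ∈ₗ xs → x ∼ y → χ (proj₁ x) ≡ χ (proj₁ y)
        resp {x} {y} x∈ y∈ x∼y = χ-piece (proj₂ x , rotIn-at (xs⇒rotIn x∈)) (proj₂ y , rotIn-at (xs⇒rotIn y∈)) (whole x∼y)

        -- Interleaving is invariant under rotation. The cases count how many of the four darts come
        -- before the place where the rotation was cut, and the equalities within each pair
        -- translate the colours back.
        noncrossing : ∀ {p q p′ q′} → p ∷ q ∷ p′ ∷ q′ ∷ [] ⊑ xs → p ∼ p′ → q ∼ q′ → χ (proj₁ p) ≡ χ (proj₁ q)
        noncrossing {p} {q} {p′} {q′} s p∼p′ q∼q′ = cases (⊑-++⁻ (d₀ ∷ zs) s)
          where
            ∈xs : ∀ {x} → x ∈ₗ p ∷ q ∷ p′ ∷ q′ ∷ [] → x ∈ₗ xs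
            ∈xs x∈ = Sub.lookup s x∈
            p≡p′ : χ (proj₁ p) ≡ χ (proj₁ p′)
            p≡p′ = resp (∈xs (here refl)) (∈xs (there (there (here refl)))) p∼p′
            q≡q′ : χ (proj₁ q) ≡ χ (proj₁ q′)
            q≡q′ = resp (∈xs (there (here refl))) (∈xs (there (there (there (here refl))))) q∼q′
            unrotate : ∀ {us vs} → us ⊑ d₀ ∷ zs → vs ⊑ ys → vs ++ us ⊑ rot w
            unrotate s₁ s₂ = Sub.⊆-trans (subst (_ ⊑_) (sym rotated) (++⁺ s₂ s₁)) (filter-⊆ (λ d → proj₁ d ∈? X) (rot w))
            cases : ∃₂ (λ us vs → p ∷ q ∷ p′ ∷ q′ ∷ [] ≡ us ++ vs × us ⊑ d₀ ∷ zs × vs ⊑ ys) → χ (proj₁ p) ≡ χ (proj₁ q)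
            cases ([] , _ , refl , s₁ , s₂) = χ-noncrossing (unrotate s₁ s₂) (whole p∼p′) (whole q∼q′)
            cases (_ ∷ [] , _ , refl , s₁ , s₂) = trans p≡p′ (sym (χ-noncrossing (unrotate s₁ s₂) (whole q∼q′) (whole (piece-sym p∼p′))))
            cases (_ ∷ _ ∷ [] , _ , refl , s₁ , s₂) = trans p≡p′ (trans (χ-noncrossing (unrotate s₁ s₂) (whole (piece-sym p∼p′)) (whole (piece-sym q∼q′))) (sym q≡q′))
            cases (_ ∷ _ ∷ _ ∷ [] , _ , refl , s₁ , s₂) = trans (sym (χ-noncrossing (unrotate s₁ s₂) (whole (piece-sym q∼q′)) (whole p∼p′))) (sym q≡q′)
            cases (_ ∷ _ ∷ _ ∷ _ ∷ [] , [] , refl , s₁ , s₂) = χ-noncrossing (unrotate s₁ s₂) (whole p∼p′) (whole q∼q′)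
            cases (_ ∷ _ ∷ _ ∷ _ ∷ _ ∷ _ , _ , () , _ , _)

        open ClosedInterval _∼_ (λ d d′ → piece? X w (proj₁ d) (proj₁ d′)) piece-sym (χ ∘ proj₁) xs resp noncrossing d₀ public

        -- `Q` consists of the pieces through the interval. As the interval is closed, `Q` has no
        -- further darts at `w`, and those of `P` form the complementary arc that a join demands.
        interval⇒split : Result → Split X w d₀
        interval⇒split (us , r , R , ts , eq , d₀∈us , (c , allR) , closed) =
            build (reachable (Linked X w) (Linked? X w) (edges-of (r ∷ R)))
          where
            ∈xsᴿ : ∀ {d} → d ∈ₗ r ∷ R → d ∈ₗ xs
            ∈xsᴿ d∈ = subst (_ ∈ₗ_) (sym eq) (∈-++⁺ʳ us (∈-++⁺ˡ d∈))
            build : ∃[ S ] (edges-of (r ∷ R) ⊆ S × (∀ {x} → x ∈ S → ∃[ s ] (s ∈ edges-of (r ∷ R) × Star (Linked X w) s x)) ×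
              (∀ {x y} → x ∈ S → Linked X w x y → y ∈ S)) → Split X w d₀
            build (Q , R⊆Q , sound , Q-closed) = record
                { P = P ; Q = Q
                ; join = (( _ , d₀∈P) , (_ , r∈Q) , (λ e e∈P → P∉Q e∈P) , P-conn , Q-conn ,
                    At⇒Inc d₀∈P (proj₂ d₀ , d₀-at) , At⇒Inc r∈Q (proj₂ r , R-at (here refl)) , meet) ,
                    subst (λ Y → CyclicInterval P (rotIn Y w)) (sym P∪Q) interval
                ; P∪Q = P∪Q
                ; d₀∈P = d₀∈P
                ; P-closed = P-closed
                ; colour = c
                ; Q-colour = λ { e∈ (b , at) → All.lookup allR (in-R (rotIn⇒xs (in-rotIn at (Q⊆X e∈))) e∈) }
                }
              where
                P : E
                P = X ∩ ∁ Q
                P⊆X : P ⊆ X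
                P⊆X e∈ = proj₁ (x∈p∩q⁻ X (∁ Q) e∈)
                P∉Q : ∀ {e} → e ∈ P → e ∉ Q
                P∉Q e∈ = x∈∁p⇒x∉p (proj₂ (x∈p∩q⁻ X (∁ Q) e∈))
                ∈P : ∀ {e} → e ∈ X → e ∉ Q → e ∈ P
                ∈P e∈ e∉ = x∈p∩q⁺ (e∈ , x∉p⇒x∈∁p e∉)
                R-at : ∀ {d} → d ∈ₗ r ∷ R → vt d ≡ w
                R-at d∈ = rotIn-at (xs⇒rotIn (∈xsᴿ d∈))
                r∈Q : proj₁ r ∈ Q
                r∈Q = R⊆Q (∈-edges-of⁺ {r} {r ∷ R} (here refl))
                source : ∀ {e} → e ∈ Q → ∃[ d ] (d ∈ₗ r ∷ R × Star (Linked X w) (proj₁ d) e)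
                source e∈ with sound e∈
                ... | s , s∈ , links with ∈-edges-of⁻ (r ∷ R) s∈
                ... | d , d∈ , refl = d , d∈ , links
                Q⊆X : Q ⊆ X
                Q⊆X e∈ with source e∈
                ... | d , d∈ , links = proj₁ (stay {X} {X} (λ { _ (_ , e′∈ , _) → e′∈ }) (∈rotIn {u = w} (xs⇒rotIn (∈xsᴿ d∈))) links)
                in-R : ∀ {d} → d ∈ₗ xs → proj₁ d ∈ Q → d ∈ₗ r ∷ R
                in-R d∈ e∈ with source e∈
                ... | s , s∈ , links = closed s∈ d∈ links
                P-closed : ∀ {e e′} → e ∈ P → Linked X w e e′ → e′ ∈ P
                P-closed e∈ l@(_ , e′∈ , _) = ∈P e′∈ (λ e′∈Q → P∉Q e∈ (Q-closed e′∈Q (Linked-sym l)))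
                outside : ∀ {d} → d ∈ₗ us ⊎ d ∈ₗ ts → proj₁ d ∈ P
                outside {d} d∈ = ∈P (∈rotIn {u = w} (xs⇒rotIn d∈xs)) (λ e∈Q → away d∈ (in-R d∈xs e∈Q))
                  where
                    place : d ∈ₗ us ⊎ d ∈ₗ ts → d ∈ₗ xs
                    place (inj₁ d∈u) = subst (d ∈ₗ_) (sym eq) (∈-++⁺ˡ d∈u)
                    place (inj₂ d∈t) = subst (d ∈ₗ_) (sym eq) (∈-++⁺ʳ us (∈-++⁺ʳ (r ∷ R) d∈t))
                    d∈xs = place d∈
                    u = subst Unique eq xs-unique
                    away : d ∈ₗ us ⊎ d ∈ₗ ts → d ∉ₗ r ∷ R
                    away (inj₁ d∈u) d∈R = unique-disjoint us u d∈u (∈-++⁺ˡ d∈R)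
                    away (inj₂ d∈t) d∈R = unique-disjoint (r ∷ R) (unique-suffix us u) d∈R d∈t
                d₀∈P : proj₁ d₀ ∈ P
                d₀∈P = outside (inj₁ d₀∈us)
                P∪Q : P ∪ Q ≡ X
                P∪Q = ⊆-antisym left right
                  where
                    left : P ∪ Q ⊆ X
                    left e∈ with x∈p∪q⁻ P Q e∈
                    ... | inj₁ e∈P = P⊆X e∈P
                    ... | inj₂ e∈Q = Q⊆X e∈Q
                    right : X ⊆ P ∪ Q
                    right {e} e∈ with e ∈? Q
                    ... | yes e∈Q = x∈p∪q⁺ (inj₂ e∈Q)
                    ... | no e∉Q = x∈p∪q⁺ (inj₁ (∈P e∈ e∉Q))
                X-inc : Inc X w
                X-inc = At⇒Inc d₀∈ (proj₂ d₀ , d₀-at)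
                through : ∀ {S} → S ⊆ X → (∀ {e e′} → e ∈ S → Linked X w e e′ → e′ ∈ S) → Connected S
                through {S} S⊆X S-closed = connected-through λ e∈ → restrict e∈ (reaches conn X-inc (S⊆X e∈))
                  where
                    restrict : ∀ {e} → e ∈ S → ∃[ d ] (vt d ≡ w × proj₁ d ∈ X × Star (Linked X w) e (proj₁ d)) →
                      ∃[ d ] (vt d ≡ w × Star (Linked S w) e (proj₁ d))
                    restrict e∈ (d , at , _ , links) = d , at , proj₂ (stay {X} {S} S-closed e∈ links)
                P-conn : Connected P
                P-conn = through P⊆X P-closed
                Q-conn : Connected Q
                Q-conn = through Q⊆X Q-closed
                meet : ∀ u → Inc P u → Inc Q u → u ≡ w
                meet u incP incQ with u ≟ w
                ... | yes u≡w = u≡w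
                ... | no u≢w with Inc⇒At incP | Inc⇒At incQ
                ... | e , e∈P , at | e′ , e′∈Q , at′ =
                  ⊥-elim (P∉Q (P-closed e∈P (P⊆X e∈P , Q⊆X e′∈Q , u , u≢w , at , at′)) e′∈Q)
                -- The darts of `P` surround the interval in `xs`; one more rotation turns them into
                -- the single block `ts ++ us` in front of it.
                interval : CyclicInterval P (rotIn X w)
                interval with rotate-again ys (d₀ ∷ zs) (us ++ r ∷ R) ts rotated (trans eq (sym (++-assoc us (r ∷ R) ts)))
                ... | ys′ , zs′ , eq₁ , eq₂ = ys′ , zs′ , ts ++ us , r ∷ R , eq₁ , trans eq₂ (sym (++-assoc ts us (r ∷ R))) ,
                  AllP.++⁺ (All.tabulate (λ d∈ → outside (inj₂ d∈))) (All.tabulate (λ d∈ → outside (inj₁ d∈))) ,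
                  All.tabulate (λ {d} d∈ d∈P → P∉Q d∈P (R⊆Q (∈-edges-of⁺ {d} {r ∷ R} d∈)))

      split : ∀ {d₁} → vt d₁ ≡ w → proj₁ d₁ ∈ X → χ (proj₁ d₁) ≢ χ (proj₁ d₀) → Split X w d₀
      split {d₁} d₁-at d₁∈ differ = from (∈-∃++ (in-rotIn d₀-at d₀∈))
        where
          from : ∃₂ (λ ys zs → rotIn X w ≡ ys ++ d₀ ∷ zs) → Split X w d₀
          from (ys , zs , rotated) = interval⇒split ys zs rotated
            (closed-interval ys zs rotated (zs ++ ys) refl (find-d₁ (rotIn⇒xs ys zs rotated (in-rotIn d₁-at d₁∈))))
            where
              find-d₁ : d₁ ∈ₗ d₀ ∷ zs ++ ys → Any (λ x → χ (proj₁ x) ≢ χ (proj₁ d₀)) (zs ++ ys)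
              find-d₁ (here refl) = ⊥-elim (differ refl)
              find-d₁ (there d₁∈) = lose∈ d₁∈ differ

    Monochrome : E → Set
    Monochrome X = ∃[ c ] (∀ {e} → e ∈ X → χ e ≡ c)

    Mixed : E → Set
    Mixed X = ∃₂ λ e e′ → e ∈ X × e′ ∈ X × χ e ≢ χ e′

    monochrome-or-mixed : ∀ {X} → Nonempty X → Monochrome X ⊎ Mixed X
    monochrome-or-mixed {X} (e , e∈) with FP.any? (λ e′ → (e′ ∈? X) ×-dec ¬? (χ e ≟ᵇ χ e′))
    ... | yes (e′ , e′∈ , differ) = inj₂ (e , e′ , e∈ , e′∈ , differ)
    ... | no none = inj₁ (χ e , same)
      where
        same : ∀ {e′} → e′ ∈ X → χ e′ ≡ χ e
        same {e′} e′∈ with χ e ≟ᵇ χ e′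
        ... | yes eq = sym eq
        ... | no differ = ⊥-elim (none (e′ , e′∈ , differ))

    MixedAt : E → Fin nV → Set
    MixedAt X w = ∃₂ λ (d d′ : Dart nE) → vt d ≡ w × vt d′ ≡ w × proj₁ d ∈ X × proj₁ d′ ∈ X × χ (proj₁ d) ≢ χ (proj₁ d′)

    -- Consecutive edges of a walk from `e` to `e′` share a vertex, and the colour has to change at
    -- one of these vertices.
    mixed-vertex : ∀ {X} → Connected X → Mixed X → ∃[ w ] MixedAt X w
    mixed-vertex {X} conn (e , e′ , e∈ , e′∈ , differ) =
        along (Star.map Step⇒Within (conn (vt (e , false)) (vt (e′ , false)) (At⇒Inc e∈ (false , refl)) (At⇒Inc e′∈ (false , refl))))
          e∈ (false , refl) differ
      where
        along : ∀ {u x} → Star (Within (λ _ → ⊤) X) u (vt (e′ , false)) → x ∈ X → At x u → χ x ≢ χ e′ → ∃[ w ] MixedAt X w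
        along {u} {x} ε x∈ (b , at) differ = u , (x , b) , (e′ , false) , at , refl , x∈ , e′∈ , differ
        along {u} {x} ((y , c , y∈ , at-y , at-y′ , _) ◅ path) x∈ (b , at) differ with χ x ≟ᵇ χ y
        ... | no x≢y = u , (x , b) , (y , c) , at , at-y , x∈ , y∈ , x≢y
        ... | yes x≡y = along path y∈ (not c , at-y′) (λ y≡e′ → differ (trans x≡y y≡e′))

    other-colour : ∀ {X w} → MixedAt X w → ∀ c → ∃[ d ] (vt d ≡ w × proj₁ d ∈ X × χ (proj₁ d) ≢ c)
    other-colour (d , d′ , at , at′ , d∈ , d′∈ , differ) c with χ (proj₁ d) ≟ᵇ c
    ... | no d≢c = d , at , d∈ , d≢c
    ... | yes refl = d′ , at′ , d′∈ , λ eq → differ (sym eq)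

    -- A walk in `P` never meets `v`, so each of its turns is a link; a connected subgraph that
    -- misses `v` lies in one piece there.
    connected-off : ∀ {X P v} → P ⊆ X → ¬ Inc P v → ∀ {u u′ e e′} → Star (Within (λ _ → ⊤) P) u u′ →
      e ∈ P → e′ ∈ P → At e u → At e′ u′ → Star (Linked X v) e e′
    connected-off P⊆X off {u} ε e∈ e′∈ at at′ =
      (P⊆X e∈ , P⊆X e′∈ , u , (λ { refl → off (At⇒Inc e∈ at) }) , at , at′) ◅ ε
    connected-off P⊆X off {u} ((y , c , y∈ , at-y , at-y′ , _) ◅ path) e∈ e′∈ at at′ =
      (P⊆X e∈ , P⊆X y∈ , u , (λ { refl → off (At⇒Inc e∈ at) }) , at , (c , at-y)) ◅
      connected-off P⊆X off path y∈ e′∈ (not c , at-y′) at′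

    Peeled : E → Set
    Peeled X = ∃₂ λ P Q → (∃[ v ] Join P Q v) × P ∪ Q ≡ X × Monochrome Q

    -- If Q has both colours, a splitting at a vertex of Q away from w whose
    -- first part contains P has a strictly smaller second part.
    peel : ∀ n {X w d₀} → Connected X → vt d₀ ≡ w → (S : Split X w d₀) → ∣ Split.Q S ∣ ≤ n → Peeled X
    peel n {X} {w} {d₀} conn d₀-at S ≤n = dispatch (monochrome-or-mixed Q-nonempty)
      where
        open Split S
        one-sum : OneSum P Q w
        one-sum = proj₁ join
        Q-nonempty : Nonempty Q
        Q-nonempty = proj₁ (proj₂ one-sum)
        disjoint : Disjoint P Q
        disjoint = proj₁ (proj₂ (proj₂ one-sum))
        P-conn : Connected P
        P-conn = proj₁ (proj₂ (proj₂ (proj₂ one-sum)))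
        Q-conn : Connected Q
        Q-conn = proj₁ (proj₂ (proj₂ (proj₂ (proj₂ one-sum))))
        meet : ∀ u → Inc P u → Inc Q u → u ≡ w
        meet = proj₂ (proj₂ (proj₂ (proj₂ (proj₂ (proj₂ (proj₂ one-sum))))))
        P⊆X : P ⊆ X
        P⊆X e∈ = subst (_ ∈_) P∪Q (x∈p∪q⁺ (inj₁ e∈))
        Q⊆X : Q ⊆ X
        Q⊆X e∈ = subst (_ ∈_) P∪Q (x∈p∪q⁺ (inj₂ e∈))
        shrinks : ∀ {v d₁} → MixedAt Q v → Star (Linked X v) (proj₁ d₀) (proj₁ d₁) → (S′ : Split X v d₁) → ∣ Split.Q S′ ∣ < ∣ Q ∣
        shrinks {v} {d₁} mixed@(d , d′ , at , at′ , d∈ , d′∈ , differ) links S′ = p⊂q⇒∣p∣<∣q∣ (Q′⊆Q , omitted)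
          where
            module S′ = Split S′
            v≢w : v ≢ w
            -- At `w` all edges of `Q` have one colour, so a mixed vertex of `Q` is elsewhere and
            -- `P` misses it.
            v≢w refl = differ (trans (Q-colour d∈ (proj₂ d , at)) (sym (Q-colour d′∈ (proj₂ d′ , at′))))
            off : ¬ Inc P v
            off inc = v≢w (meet v inc (At⇒Inc d∈ (proj₂ d , at)))
            P⊆P′ : P ⊆ S′.P
            P⊆P′ {e} e∈ = proj₁ (stay {X} {S′.P} S′.P-closed S′.d₀∈P (piece-sym links ◅◅
              connected-off P⊆X off (Star.map Step⇒Within (P-conn w (vt (e , false)) (At⇒Inc d₀∈P (proj₂ d₀ , d₀-at)) (At⇒Inc e∈ (false , refl))))
                d₀∈P e∈ (proj₂ d₀ , d₀-at) (false , refl)))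
            Q′⊆Q : S′.Q ⊆ Q
            Q′⊆Q {e} e∈ with x∈p∪q⁻ P Q (subst (e ∈_) (trans S′.P∪Q (sym P∪Q)) (x∈p∪q⁺ (inj₂ e∈)))
            ... | inj₂ e∈Q = e∈Q
            ... | inj₁ e∈P = ⊥-elim (proj₁ (proj₂ (proj₂ (proj₁ S′.join))) e (P⊆P′ e∈P) e∈)
            -- `Q` has both colours at `v` and the new second part has one, which makes the
            -- inclusion strict.
            omitted : ∃[ e ] (e ∈ Q × e ∉ S′.Q)
            omitted with other-colour {Q} mixed S′.colour
            ... | (e , b) , e-at , e∈ , e≢ = e , e∈ , λ e∈′ → e≢ (S′.Q-colour e∈′ (b , e-at))
        descend : ∀ n → ∣ Q ∣ ≤ n → ∀ {v d₁} → vt d₁ ≡ v → (S′ : Split X v d₁) → ∣ Split.Q S′ ∣ < ∣ Q ∣ → Peeled X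
        descend zero ≤0 _ _ lt with ℕ.<-≤-trans lt ≤0
        ... | ()
        descend (suc n) ≤n d₁-at S′ lt = peel n conn d₁-at S′ (ℕ.≤-pred (ℕ.<-≤-trans lt ≤n))
        -- The new base dart `d₁` at `v` is taken from the piece of `d₀`. It stays in the first
        -- part, and the connected `P` stays with it.
        retry : ∀ {v} → MixedAt Q v → ∃[ d₁ ] (vt d₁ ≡ v × proj₁ d₁ ∈ X × Star (Linked X v) (proj₁ d₀) (proj₁ d₁)) → Peeled X
        retry {v} mixed (d₁ , d₁-at , d₁∈ , links) = from (other-colour {Q} mixed (χ (proj₁ d₁)))
          where
            from : ∃[ d ] (vt d ≡ v × proj₁ d ∈ Q × χ (proj₁ d) ≢ χ (proj₁ d₁)) → Peeled X
            from (d , at , d∈ , differ) = continue (split conn d₁-at d₁∈ at (Q⊆X d∈) differ)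
              where
                continue : Split X v d₁ → Peeled X
                continue S′ = descend n ≤n d₁-at S′ (shrinks mixed links S′)
        dispatch : Monochrome Q ⊎ Mixed Q → Peeled X
        dispatch (inj₁ mono) = P , Q , (w , join) , P∪Q , mono
        dispatch (inj₂ mixed) = from (mixed-vertex Q-conn mixed)
          where
            from : ∃[ v ] MixedAt Q v → Peeled X
            from (v , mixed-v@(d , _ , at , _ , d∈ , _)) =
              retry mixed-v (reaches conn (At⇒Inc (Q⊆X d∈) (proj₂ d , at)) (P⊆X d₀∈P))

    -- Join sequences associate to the left and so grow at the end: the peeled `Q` is appended to a
    -- decomposition of the smaller connected `P`.
    decompose : ∀ n {X} → ∣ X ∣ ≤ n → Nonempty X → Connected X →
      ∃₂ λ H Hs → JoinSeq H Hs × foldl _∪_ H Hs ≡ X × All Monochrome (H ∷ Hs)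
    decompose n {X} ≤n nonempty conn = dispatch (monochrome-or-mixed nonempty)
      where
        MonochromeJoins : E → Set
        MonochromeJoins X = ∃₂ λ H Hs → JoinSeq H Hs × foldl _∪_ H Hs ≡ X × All Monochrome (H ∷ Hs)
        append : ∀ {P Q} → ∃[ v ] Join P Q v → P ∪ Q ≡ X → Monochrome Q → MonochromeJoins P → MonochromeJoins X
        append {P} {Q} joined P∪Q mono (H , Hs , joins , whole , monos) =
          H , Hs ++ [ Q ] , JoinSeq-snoc H Hs joins (subst (λ P → ∃[ v ] Join P Q v) (sym whole) joined) ,
          trans (foldl-++ _∪_ H Hs [ Q ]) (trans (cong (_∪ Q) whole) P∪Q) , AllP.++⁺ monos (mono ∷ [])
        recurse : ∀ n → ∣ X ∣ ≤ n → Peeled X → MonochromeJoins X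
        recurse n ≤n (P , Q , joined@(v , (P-nonempty , (q , q∈) , disjoint , P-conn , _) , _) , P∪Q , mono) = go n ≤n
          where
            P⊂X : ∣ P ∣ < ∣ X ∣
            P⊂X = p⊂q⇒∣p∣<∣q∣ ((λ e∈ → subst (_ ∈_) P∪Q (x∈p∪q⁺ (inj₁ e∈))) , q , subst (q ∈_) P∪Q (x∈p∪q⁺ (inj₂ q∈)) , λ q∈P → disjoint q q∈P q∈)
            go : ∀ n → ∣ X ∣ ≤ n → MonochromeJoins X
            go zero ≤0 with ℕ.<-≤-trans P⊂X ≤0
            ... | ()
            go (suc n) ≤n = append joined P∪Q mono (decompose n (ℕ.≤-pred (ℕ.<-≤-trans P⊂X ≤n)) P-nonempty P-conn)
        dispatch : Monochrome X ⊎ Mixed X → MonochromeJoins X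
        dispatch (inj₁ mono) = X , [] , tt , refl , mono ∷ []
        dispatch (inj₂ mixed) = from (mixed-vertex conn mixed)
          where
            from : ∃[ w ] MixedAt X w → MonochromeJoins X
            from (w , d , d′ , at , at′ , d∈ , d′∈ , differ) =
              recurse n ≤n (peel _ conn at (split conn at d∈ at′ d′∈ (λ eq → differ (sym eq))) ℕ.≤-refl)

  -- Toggling the summands one by one.

  Δ-lookup : ∀ (A B : E) e → lookup (A Δ B) e ≡ lookup A e xor lookup B e
  Δ-lookup A B e = lookup-zipWith _xor_ e A B

  module Toggling (A D : E) {H₀ Hs₀} (decomposition : JoinDecomp (H₀ ∷ Hs₀)) where

    -- The state once the summands that make up `X` have been treated: `A` for empty `X`, and
    -- `A Δ D` for the whole edge set.
    target : E → E
    target X = A Δ (D ∩ X)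

    target-lookup : ∀ X e → lookup (target X) e ≡ lookup A e xor (lookup D e ∧ lookup X e)
    target-lookup X e = trans (Δ-lookup A (D ∩ X) e) (cong (lookup A e xor_) (lookup-zipWith _∧_ e D X))

    -- A summand inside `D` costs one toggle and a summand outside `D` none. In the first case
    -- disjointness from `acc` ensures that all of `H` is new.
    toggle-one : ∀ {acc H} → Disjoint acc H → ∃[ c ] (∀ {e} → e ∈ H → lookup D e ≡ c) → H ∈ₗ H₀ ∷ Hs₀ →
      Star Toggle (target acc) (target (acc ∪ H))
    toggle-one {acc} {H} disj (true , mono) H∈ = (H₀ ∷ Hs₀ , decomposition , H , H∈ , lookup-ext pointwise) ◅ ε
      where
        pointwise : ∀ e → lookup (target (acc ∪ H)) e ≡ lookup (target acc Δ H) e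
        pointwise e = trans (target-lookup (acc ∪ H) e) (trans (cong (λ b → lookup A e xor (lookup D e ∧ b)) (lookup-zipWith _∨_ e acc H))
            (trans (identity (lookup A e) (lookup D e) (lookup acc e) (lookup H e) D-on-H acc-off-H)
              (sym (trans (Δ-lookup (target acc) H e) (cong (_xor lookup H e) (target-lookup acc e))))))
          where
            D-on-H : lookup H e ≡ true → lookup D e ≡ true
            D-on-H He = mono (lookup⇒[]= e H He)
            acc-off-H : lookup H e ≡ true → lookup acc e ≡ false
            acc-off-H He = ∉⇒lookup (λ e∈ → disj e e∈ (lookup⇒[]= e H He))
            identity : ∀ a d x h → (h ≡ true → d ≡ true) → (h ≡ true → x ≡ false) →
              a xor (d ∧ (x ∨ h)) ≡ (a xor (d ∧ x)) xor h
            identity a d x false _ _ = trans (cong (λ x → a xor (d ∧ x)) (∨-identityʳ x)) (sym (xor-identityʳ _))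
            identity a d x true d≡ x≡ rewrite d≡ refl | x≡ refl = cong (_xor true) (sym (xor-identityʳ a))
    toggle-one {acc} {H} disj (false , mono) H∈ = subst (Star Toggle (target acc)) (lookup-ext pointwise) ε
      where
        pointwise : ∀ e → lookup (target acc) e ≡ lookup (target (acc ∪ H)) e
        pointwise e = trans (target-lookup acc e) (trans (cong (lookup A e xor_) (identity (lookup D e) (lookup acc e) (lookup H e) (λ He → mono (lookup⇒[]= e H He))))
            (sym (trans (target-lookup (acc ∪ H) e) (cong (λ b → lookup A e xor (lookup D e ∧ b)) (lookup-zipWith _∨_ e acc H)))))
          where
            identity : ∀ d x h → (h ≡ true → d ≡ false) → d ∧ x ≡ d ∧ (x ∨ h)
            identity d x false _ = cong (d ∧_) (sym (∨-identityʳ x))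
            identity d x true d≡ rewrite d≡ refl = refl

    toggle-all : ∀ acc Hs → JoinSeq acc Hs → All (λ H → ∃[ c ] (∀ {e} → e ∈ H → lookup D e ≡ c)) Hs →
      (∀ {H} → H ∈ₗ Hs → H ∈ₗ H₀ ∷ Hs₀) → Star Toggle (target acc) (target (foldl _∪_ acc Hs))
    toggle-all acc [] _ _ _ = ε
    toggle-all acc (H ∷ Hs) ((v , (_ , _ , disj , _) , _) , joins) (mono ∷ monos) ⊆Hs =
      toggle-one disj mono (⊆Hs (here refl)) ◅◅ toggle-all (acc ∪ H) Hs joins monos (⊆Hs ∘ there)

  module _ (connG : ConnectedG) where

    -- The topology enters through the last hypothesis alone. Its two halves are the cases in which
    -- exactly one of `A` and `B` has the crossing pieces on the same side.
    related : ∀ {A B} → Biseparation A → Biseparation B →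
      (∀ {w} {p q p′ q′ : Dart nE} → p ∷ q ∷ p′ ∷ q′ ∷ [] ⊑ rot w →
        Star (Linked Eₛ w) (proj₁ p) (proj₁ p′) → Star (Linked Eₛ w) (proj₁ q) (proj₁ q′) →
        ¬ Star (Linked Eₛ w) (proj₁ p) (proj₁ q) →
        (lookup A (proj₁ p) ≡ lookup A (proj₁ q) → lookup B (proj₁ p) ≢ lookup B (proj₁ q) → ⊥) ×
        (lookup B (proj₁ p) ≡ lookup B (proj₁ q) → lookup A (proj₁ p) ≢ lookup A (proj₁ q) → ⊥)) →
      Star Toggle A B
    related {A} {B} bisepA bisepB crossing = start (nonempty? Eₛ)
      where
        D : E
        D = A Δ B
        χ-piece : ∀ {w e e′} → At e w → At e′ w → Star (Linked Eₛ w) e e′ → lookup D e ≡ lookup D e′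
        χ-piece {w} {e} {e′} at at′ links = trans (Δ-lookup A B e) (trans (cong₂ _xor_ (piece-same-side connG bisepA at at′ links)
          (piece-same-side connG bisepB at at′ links)) (sym (Δ-lookup A B e′)))
        χ-noncrossing : ∀ {w} {p q p′ q′ : Dart nE} → p ∷ q ∷ p′ ∷ q′ ∷ [] ⊑ rot w →
          Star (Linked Eₛ w) (proj₁ p) (proj₁ p′) → Star (Linked Eₛ w) (proj₁ q) (proj₁ q′) → lookup D (proj₁ p) ≡ lookup D (proj₁ q)
        χ-noncrossing {w} {p} {q} s p∼p′ q∼q′ with lookup D (proj₁ p) ≟ᵇ lookup D (proj₁ q)
        ... | yes same = same
        ... | no differ = ⊥-elim (decide (lookup A (proj₁ p) ≟ᵇ lookup A (proj₁ q)) (lookup B (proj₁ p) ≟ᵇ lookup B (proj₁ q)))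
          where
            apart : ¬ Star (Linked Eₛ w) (proj₁ p) (proj₁ q)
            apart links = differ (χ-piece (proj₂ p , vt-unique (Sub.lookup s (here refl))) (proj₂ q , vt-unique (Sub.lookup s (there (here refl)))) links)
            D≡ : lookup A (proj₁ p) xor lookup B (proj₁ p) ≡ lookup A (proj₁ q) xor lookup B (proj₁ q) → ⊥
            D≡ eq = differ (trans (Δ-lookup A B (proj₁ p)) (trans eq (sym (Δ-lookup A B (proj₁ q)))))
            both-flip : ∀ {a b a′ b′} → a ≢ a′ → b ≢ b′ → a xor b ≡ a′ xor b′
            both-flip {a} {b} {a′} {b′} a≢ b≢ rewrite ≢⇒≡not a≢ | ≢⇒≡not b≢ = not-not a′ b′
              where
                not-not : ∀ a b → not a xor not b ≡ a xor b
                not-not false b = not-involutive b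
                not-not true b = refl
            -- The colours in `D` differ exactly when one of `A` and `B` separates `p` from `q` and
            -- the other does not; if both or neither do, the colours agree.
            decide : Dec (lookup A (proj₁ p) ≡ lookup A (proj₁ q)) → Dec (lookup B (proj₁ p) ≡ lookup B (proj₁ q)) → ⊥
            decide (yes a) (yes b) = D≡ (cong₂ _xor_ a b)
            decide (no a) (no b) = D≡ (both-flip a b)
            decide (yes a) (no b) = proj₁ (crossing s p∼p′ q∼q′ apart) a b
            decide (no a) (yes b) = proj₂ (crossing s p∼p′ q∼q′ apart) b a
        open Coloured (lookup D) χ-piece χ-noncrossing
        finish : (∃₂ λ H Hs → JoinSeq H Hs × foldl _∪_ H Hs ≡ Eₛ × All Monochrome (H ∷ Hs)) → Star Toggle A B
        finish (H , Hs , joins , whole , mono ∷ monos) = subst₂ (Star Toggle) (lookup-ext from-A) (trans (cong target whole) (lookup-ext to-B))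
            (subst (λ X → Star Toggle (target ∅ₛ) (target X)) (∪-identityˡ H) (toggle-one (λ e e∈ _ → ∉⊥ e∈) mono (here refl)) ◅◅
              toggle-all H Hs joins monos there)
          where
            open Toggling A D {H} {Hs} (joins , trans (sym (foldl-union H Hs)) whole)
            from-A : ∀ e → lookup (target ∅ₛ) e ≡ lookup A e
            from-A e = trans (target-lookup ∅ₛ e) (trans (cong (λ b → lookup A e xor (lookup D e ∧ b)) (∉⇒lookup {X = ∅ₛ} {e} ∉⊥))
              (trans (cong (lookup A e xor_) (∧-zeroʳ (lookup D e))) (xor-identityʳ _)))
            to-B : ∀ e → lookup (target Eₛ) e ≡ lookup B e
            to-B e = trans (target-lookup Eₛ e) (trans (cong (λ b → lookup A e xor (lookup D e ∧ b)) (∈⇒lookup {X = Eₛ} {e} ∈⊤))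
              (trans (cong (lookup A e xor_) (trans (∧-identityʳ (lookup D e)) (Δ-lookup A B e)))
                (trans (sym (xor-assoc (lookup A e) _ _)) (cong (_xor lookup B e) (xor-same (lookup A e))))))
        start : Dec (Nonempty Eₛ) → Star Toggle A B
        start (yes nonempty) = finish (decompose _ ℕ.≤-refl nonempty (λ u w _ _ → connG u w))
        -- Without edges `decompose` has nothing to start from, but then `A` and `B` are equal.
        start (no empty) = subst (Star Toggle A) (lookup-ext (λ e → ⊥-elim (empty (e , ∈⊤)))) ε

theorem3 : (G : RibbonGraph) → RG.ConnectedG G →
    (A B : RG.E G) →
    (RG.PlaneBiseparation G A × RG.PlaneBiseparation G B)
    ⊎ (RG.RP2Biseparation G A × RG.RP2Biseparation G B) →
    RG.RelatedByToggling G A B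
theorem3 G connG A B (inj₁ (planeA , planeB)) = Decomposition.related G connG (proj₁ planeA) (proj₁ planeB)
  λ s p∼p′ q∼q′ apart →
    (λ same _ → Separation.Crossing.plane-case G connG s p∼p′ q∼q′ apart planeA same) ,
    (λ same _ → Separation.Crossing.plane-case G connG s p∼p′ q∼q′ apart planeB same)
theorem3 G connG A B (inj₂ (rp2A , rp2B)) = Decomposition.related G connG (proj₁ rp2A) (proj₁ rp2B)
  λ s p∼p′ q∼q′ apart →
    Separation.Crossing.RP2-case G connG s p∼p′ q∼q′ apart rp2A rp2B ,
    Separation.Crossing.RP2-case G connG s p∼p′ q∼q′ apart rp2B rp2A
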